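{- Let $f:\{0,1\}^n\to\{0,1\}$ be a function computable by a black box (oracle), with $f^{ -1}(1)\neq\emptyset$, and let $s\ge 2$ be a given integer parameter. There exist deterministic algorithms $\mathcal A_1,\mathcal A_2,\mathcal A_3$ that make $2^n$ oracle calls to $f$ and, in addition to that, use $O^*(2^{(s-1)n})$ time and $O^*(2^n)$ space, with the following guarantees. 1. The output of $\mathcal A_1$ is a multiset $\{z_1,\dots,z_s\}\subseteq f^{ -1}(1)$ such that $\mathrm{sumPD}(z_1,\dots,z_s)=\mathrm{OptSum}(f,s)$. 2. The output of $\mathcal A_2$ is a set $\{z_1,\dots,z_s\}\subseteq f^{ -1}(1)$ such that $\mathrm{minPD}(z_1,\dots,z_s)=\mathrm{OptMin}(f,s)$. 3. If $|f^{ -1}(1)|\ge s$, the output of $\mathcal A_3$ is a set $\{z_1,\dots,z_s\}\subseteq f^{ -1}(1)$ such that $\mathrm{sumPD}(z_1,\dots,z_s)=\mathrm{OptSum}_{\ne}(f,s)$.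
   Context: $d_H$ is Hamming distance. For $z_1,\dots,z_s\in\{0,1\}^n$, $\mathrm{sumPD}(z_1,\dots,z_s)=\sum_{i<j}d_H(z_i,z_j)$ and $\mathrm{minPD}(z_1,\dots,z_s)=\min_{i<j}d_H(z_i,z_j)$. $\mathrm{OptSum}(f,s)$ is the maximum of $\mathrm{sumPD}$ over multisets of $s$ elements (with multiplicity) of $f^{ -1}(1)$; $\mathrm{OptSum}_{\neq}(f,s)$ is the maximum of $\mathrm{sumPD}$ over sets of $s$ distinct elements of $f^{ -1}(1)$; $\mathrm{OptMin}(f,s)$ is the maximum of $\mathrm{minPD}$ over sets of $s$ elements of $f^{ -1}(1)$. If $|f^{ -1}(1)|<s$, multisets are allowed in the minPD problem (so that $\mathrm{OptMin}(f,s)=0$). $O^*$ hides factors polynomial in $n$, for fixed $s$. -}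

module Defs where

open import Data.Bool.Base using (Bool; true; false; if_then_else_)
open import Data.Bool.Properties using () renaming (_≟_ to _≟ᵇ_)
open import Data.Fin.Base using (Fin; toℕ)
open import Data.List.Base as List using (List; []; _∷_; _++_; cartesianProductWith; filter; filterᵇ; length)
open import Data.List.Extrema.Nat using (max; min)
open import Data.Nat.Base
open import Data.Nat.ListAction using (sum)
open import Data.Nat.DivMod using (_/_; _%_)
open import Data.Nat.Logarithm using (⌊log₂_⌋)
open import Data.Nat.Properties using (_≤?_)
open import Data.Product.Base using (_×_; _,_; ∃-syntax)
open import Data.Vec.Base as Vec using (Vec; []; _∷_; lookup; _[_]≔_; replicate; tabulate)
open import Data.Vec.Properties using (≡-dec)
open import Data.Vec.Relation.Unary.All using (All)
open import Data.Vec.Relation.Unary.AllPairs using (allPairs?)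
open import Data.Vec.Relation.Unary.Unique.Propositional using (Unique)
open import Relation.Binary.PropositionalEquality using (_≡_; _≢_; refl)
open import Relation.Nullary.Decidable using (Dec; ¬?; does)
open import Relation.Nullary.Negation using (contradiction)

Point : ℕ → Set
Point n = Vec Bool n

d_H : ∀ {n} → Point n → Point n → ℕ
d_H []       []       = 0
d_H (a ∷ as) (b ∷ bs) = (if does (a ≟ᵇ b) then 0 else 1) + d_H as bs

-- All d_H zᵢ zⱼ with i < j.
pairDistances : ∀ {n s} → Vec (Point n) s → List ℕ
pairDistances []       = []
pairDistances (z ∷ zs) = Vec.toList (Vec.map (d_H z) zs) ++ pairDistances zs

sumPD : ∀ {n s} → Vec (Point n) s → ℕ
sumPD zs = sum (pairDistances zs)

-- Distances never exceed n, so the starting value n of the minimum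
-- matters only when there are no pairs, i.e. when s < 2.
minPD : ∀ {n s} → Vec (Point n) s → ℕ
minPD {n} zs = min n (pairDistances zs)

-- sumPD and minPD do not depend on the order of their arguments, so
-- multisets and sets of size s are represented by s-tuples, respectively
-- by s-tuples without repetition.
tuples : ∀ {A : Set} s → List A → List (Vec A s)
tuples zero    xs = [] ∷ []
tuples (suc s) xs = cartesianProductWith _∷_ xs (tuples s xs)

unique? : ∀ {n s} (zs : Vec (Point n) s) → Dec (Unique zs)
unique? = allPairs? (λ x y → ¬? (≡-dec _≟ᵇ_ x y))

distinctTuples : ∀ {n} s → List (Point n) → List (Vec (Point n) s)
distinctTuples s xs = filter unique? (tuples s xs)

-- f⁻¹(1), each element listed exactly once.
solutions : ∀ {n} → (Point n → Bool) → List (Point n)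
solutions {n} f = filterᵇ f (tuples n (false ∷ true ∷ []))

#solutions : ∀ {n} → (Point n → Bool) → ℕ
#solutions f = length (solutions f)

maximum : ∀ {A : Set} → (A → ℕ) → List A → ℕ
maximum g xs = max 0 (List.map g xs)

OptSum : ∀ {n} → (Point n → Bool) → ℕ → ℕ
OptSum f s = maximum sumPD (tuples s (solutions f))

OptSum≠ : ∀ {n} → (Point n → Bool) → ℕ → ℕ
OptSum≠ f s = maximum sumPD (distinctTuples s (solutions f))

OptMin : ∀ {n} → (Point n → Bool) → ℕ → ℕ
OptMin f s =
  if does (s ≤? #solutions f)
  then maximum minPD (distinctTuples s (solutions f))
  else maximum minPD (tuples s (solutions f))

-- Oracle random access machines. A program is a finite piece of syntax
-- with k registers, working on an unbounded memory addressed by natural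
-- numbers. Every operation is charged the bit lengths of all numbers
-- involved, so that large numbers give no computation for free.

data Op : Set where
  add monus mul quot rem : Op

⟦_⟧ : Op → ℕ → ℕ → ℕ
⟦ add   ⟧ x y       = x + y
⟦ monus ⟧ x y       = x ∸ y
⟦ mul   ⟧ x y       = x * y
⟦ quot  ⟧ x zero    = 0
⟦ quot  ⟧ x (suc y) = x / suc y
⟦ rem   ⟧ x zero    = x
⟦ rem   ⟧ x (suc y) = x % suc y

data Expr (k : ℕ) : Set where
  lit : ℕ → Expr k
  reg : Fin k → Expr k
  op  : Op → Expr k → Expr k → Expr k

data Atom (k : ℕ) : Set where
  set   : Fin k → Expr k → Atom k   -- register := value
  load  : Fin k → Expr k → Atom k   -- register := memory[address]
  store : Expr k → Expr k → Atom k  -- memory[address] := value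
  query : Fin k → Expr k → Atom k   -- register := oracle answer (0 or 1)

infixr 5 _⨾_

data Cmd (k : ℕ) : Set where
  skip  : Cmd k
  atom  : Atom k → Cmd k
  _⨾_   : Cmd k → Cmd k → Cmd k
  cond  : Expr k → Cmd k → Cmd k → Cmd k  -- a value is true if nonzero
  while : Expr k → Cmd k → Cmd k

-- The memory is represented by the contents of cells 0, 1, …, up to the
-- highest cell written so far; all further cells contain 0.
record State (k : ℕ) : Set where
  constructor ⟨_,_⟩
  field
    regs : Vec ℕ k
    mem  : List ℕ

open State public

read : List ℕ → ℕ → ℕ
read []      _       = 0
read (x ∷ m) zero    = x
read (x ∷ m) (suc a) = read m a

write : List ℕ → ℕ → ℕ → List ℕ
write []      zero    v = v ∷ []
write []      (suc a) v = 0 ∷ write [] a v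
write (x ∷ m) zero    v = v ∷ m
write (x ∷ m) (suc a) v = x ∷ write m a v

eval : ∀ {k} → State k → Expr k → ℕ
eval σ (lit x)      = x
eval σ (reg r)      = lookup (regs σ) r
eval σ (op o e₁ e₂) = ⟦ o ⟧ (eval σ e₁) (eval σ e₂)

bits : ℕ → ℕ
bits x = suc ⌊log₂ x ⌋

-- In bits; padding cells are charged as well.
size : ∀ {k} → State k → ℕ
size σ = sum (List.map bits (Vec.toList (regs σ))) + sum (List.map bits (mem σ))

exprTime : ∀ {k} → State k → Expr k → ℕ
exprTime σ (lit x)      = bits x
exprTime σ (reg r)      = bits (lookup (regs σ) r)
exprTime σ (op o e₁ e₂) =
  exprTime σ e₁ + exprTime σ e₂ + bits (⟦ o ⟧ (eval σ e₁) (eval σ e₂))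

record Cost : Set where
  constructor cost
  field
    time space calls : ℕ

open Cost public

-- Space is a peak value, time and calls accumulate.
infixr 5 _then_

_then_ : Cost → Cost → Cost
κ then κ′ = cost (time κ + time κ′) (space κ ⊔ space κ′) (calls κ + calls κ′)

module _ {k : ℕ} (oracle : ℕ → Bool) where

  effect : Atom k → State k → State k
  effect (set r e)     σ = ⟨ regs σ [ r ]≔ eval σ e , mem σ ⟩
  effect (load r a)    σ = ⟨ regs σ [ r ]≔ read (mem σ) (eval σ a) , mem σ ⟩
  effect (store a e)   σ = ⟨ regs σ , write (mem σ) (eval σ a) (eval σ e) ⟩
  effect (query r e)   σ = ⟨ regs σ [ r ]≔ (if oracle (eval σ e) then 1 else 0) , mem σ ⟩

  atomTime : Atom k → State k → ℕ
  atomTime (set r e)   σ = suc (exprTime σ e)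
  atomTime (load r a)  σ = suc (exprTime σ a + bits (read (mem σ) (eval σ a)))
  atomTime (store a e) σ = suc (exprTime σ a + exprTime σ e)
  atomTime (query r e) σ = suc (exprTime σ e)

  atomCalls : Atom k → ℕ
  atomCalls (query _ _) = 1
  atomCalls _           = 0

  -- The space includes the scratch space needed to evaluate expressions,
  -- which is at most the time spent on them.
  atomCost : Atom k → State k → Cost
  atomCost a σ =
    cost (atomTime a σ) (atomTime a σ + (size σ ⊔ size (effect a σ))) (atomCalls a)

  testCost : Expr k → State k → Cost
  testCost e σ = cost (suc (exprTime σ e)) (suc (exprTime σ e) + size σ) 0

  -- Exec c σ σ′ κ: started in σ, the command c halts in σ′ at cost κ.
  data Exec : Cmd k → State k → State k → Cost → Set where
    skip : ∀ {σ} → Exec skip σ σ (cost 1 (size σ) 0)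
    atom : ∀ {a σ} → Exec (atom a) σ (effect a σ) (atomCost a σ)
    _⨾_  : ∀ {c c′ σ σ′ σ″ κ κ′} →
           Exec c σ σ′ κ → Exec c′ σ′ σ″ κ′ → Exec (c ⨾ c′) σ σ″ (κ then κ′)
    cond-true : ∀ {e c c′ σ σ′ κ} → eval σ e ≢ 0 →
           Exec c σ σ′ κ → Exec (cond e c c′) σ σ′ (testCost e σ then κ)
    cond-false : ∀ {e c c′ σ σ′ κ} → eval σ e ≡ 0 →
           Exec c′ σ σ′ κ → Exec (cond e c c′) σ σ′ (testCost e σ then κ)
    while-true : ∀ {e c σ σ′ σ″ κ κ′} → eval σ e ≢ 0 →
           Exec c σ σ′ κ → Exec (while e c) σ′ σ″ κ′ →
           Exec (while e c) σ σ″ (testCost e σ then κ then κ′)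
    while-false : ∀ {e c σ} → eval σ e ≡ 0 →
           Exec (while e c) σ σ (testCost e σ)

  deterministic : ∀ {c σ σ₁ σ₂ κ₁ κ₂} →
    Exec c σ σ₁ κ₁ → Exec c σ σ₂ κ₂ → σ₁ ≡ σ₂ × κ₁ ≡ κ₂
  deterministic skip skip = refl , refl
  deterministic atom atom = refl , refl
  deterministic (p ⨾ q) (p′ ⨾ q′) with deterministic p p′
  ... | refl , refl with deterministic q q′
  ... | refl , refl = refl , refl
  deterministic (cond-true _ p) (cond-true _ p′) with deterministic p p′
  ... | refl , refl = refl , refl
  deterministic (cond-true t _) (cond-false u _) = contradiction u t
  deterministic (cond-false t _) (cond-true u _) = contradiction t u
  deterministic (cond-false _ p) (cond-false _ p′) with deterministic p p′
  ... | refl , refl = refl , refl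
  deterministic (while-true _ p q) (while-true _ p′ q′) with deterministic p p′
  ... | refl , refl with deterministic q q′
  ... | refl , refl = refl , refl
  deterministic (while-true t _ _) (while-false u) = contradiction u t
  deterministic (while-false t) (while-true u _ _) = contradiction t u
  deterministic (while-false _) (while-false _) = refl , refl

record Algorithm : Set where
  field
    #regs : ℕ
    code  : Cmd #regs

open Algorithm public

-- The n low-order binary digits, least significant first; on numbers
-- below 2ⁿ this is the usual bijection with {0,1}ⁿ.
toPoint : ∀ n → ℕ → Point n
toPoint zero    x = []
toPoint (suc n) x = (x % 2 ≡ᵇ 1) ∷ toPoint n (x / 2)

-- The input n is in memory cell 0; everything else is 0.
initial : ∀ {k} → ℕ → State k
initial n = ⟨ replicate _ 0 , n ∷ [] ⟩

-- The s output points are in memory cells 0, …, s-1.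
output : ∀ {k} n s → State k → Vec (Point n) s
output n s σ = tabulate (λ i → toPoint n (read (mem σ) (toℕ i)))

_⇓[_]_,_ : ∀ {n} (A : Algorithm) → (Point n → Bool) → State (#regs A) → Cost → Set
_⇓[_]_,_ {n} A f σ κ = Exec (λ x → f (toPoint n x)) (code A) (initial n) σ κ

O* : (ℕ → ℕ) → (ℕ → ℕ) → Set
O* h g = ∃[ c ] ∃[ d ] (∀ n → g n ≤ c * suc n ^ d * h n)

Nonempty : ∀ {n} → (Point n → Bool) → Set
Nonempty f = ∃[ z ] f z ≡ true

_⊆_⁻¹1 : ∀ {n s} → Vec (Point n) s → (Point n → Bool) → Set
zs ⊆ f ⁻¹1 = All (λ z → f z ≡ true) zs

-- The time and space bounds T and S do not depend on f, and A does not
-- depend on n or f.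
Computes : (s : ℕ) → Algorithm → (∀ {n} → (Point n → Bool) → Vec (Point n) s → Set) → Set
Computes s A Guarantee =
  ∃[ T ] ∃[ S ]
    O* (λ n → 2 ^ ((s ∸ 1) * n)) T ×
    O* (λ n → 2 ^ n) S ×
    (∀ n (f : Point n → Bool) → Nonempty f →
      ∃[ σ ] ∃[ κ ]
        (A ⇓[ f ] σ , κ) ×
        calls κ ≡ 2 ^ n ×
        time κ ≤ T n ×
        space κ ≤ S n ×
        Guarantee f (output n s σ))

{-# OPTIONS --safe #-}

-- Enumerate a threshold D and all but two of the s points. For a fixed
-- choice C of these, every solution y gets a weight w(y), and a best pair
-- (x, y) is one maximizing w(x) + w(y) + d_H x y. The values
-- max_y (w(y) + d_H x y) for all x are computed together in n rounds over a
-- table of 2ⁿ cells, round i using T(x) := max(T(x), T(x with digit i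
-- flipped) + 1). After i rounds T(x) is the maximum over the y in the block
-- of x of length 2ⁱ, so that the candidates T(x with digit i flipped) + 1
-- range over y ≠ x only; this is what makes distinct points possible.
--
-- All three problems are instances of one search for s solutions at mutual
-- distance at least D which maximizes α * sumPD + D: (α, D) = (1, 0) for
-- multisets, (1, 1) for sets, and α = 0 with D ranging over 0, …, n for
-- minPD. Witnesses are carried along by packing them into the low-order
-- digits of the values being maximized.
module Submission where

-- The weight of `y` depends only on `y` and the fixed points `C`. So the constraint between `x` and
-- `y` themselves cannot enter it, and the table maximizes over all `y`, including non-solutions.
-- The first obstacle explains the two modes: for `α = 0`, among partners satisfying the other
-- constraints, one farthest from `x` also satisfies this one if any does; for `D ≤ 1` the
-- constraint says at most that `y` differs from `x`. The second is met by counting satisfied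
-- constraints: the count enters the weight with a factor `K` exceeding the distances involved, so a
-- partner violating a constraint never beats one satisfying all of them. Every candidate found
-- through the table is scored afresh as a whole tuple. The table therefore matters for completeness
-- only: for each scattered tuple, a candidate at least as good must have been tried. It is
-- overwritten from one choice of `C` and `D` to the next, which keeps the space at `2 ^ n` up to
-- polynomial factors.

open import Defs
open import Data.Bool.Base using (Bool; true; false; if_then_else_)
open import Data.Bool.Properties using (T?; T-≡) renaming (_≟_ to _≟ᵇ_)
open import Data.Fin.Base using (Fin; zero; suc; toℕ)
open import Data.List.Base as List using (List; []; _∷_; length)
open import Data.List.Extrema.Nat using (xs≤max; max≤v⁺; v≤min⁺; min≤xs; min≤⊤)
open import Data.List.Membership.Propositional using (_∈_)
open import Data.List.Membership.Propositional.Properties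
  using (∈-cartesianProductWith⁺; ∈-cartesianProductWith⁻; ∈-filter⁺; ∈-filter⁻; ∈-map⁺)
open import Data.List.Relation.Unary.All as LAll using ([]; _∷_)
open import Data.List.Relation.Unary.All.Properties using (++⁺; ++⁻ˡ; ++⁻ʳ) renaming (map⁺ to map-All⁺)
open import Data.List.Relation.Unary.AllPairs as LAllPairs using ([]; _∷_)
open import Data.List.Relation.Unary.Any using (here; there)
import Data.List.Relation.Unary.Unique.Propositional as LUnique
open import Data.List.Relation.Unary.Unique.Propositional.Properties using (cartesianProductWith⁺; filter⁺)
open import Data.Nat.Base hiding (parity)
open import Data.Nat.DivMod
  using (m≡m%n+[m/n]*n; [m+kn]%n≡m%n; m<n⇒m%n≡m; m%n<n; m%n≤m; m/n≤m; m<n*o⇒m/o<n; m<n⇒m/n≡0; n/1≡n; n/n≡1)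
open import Data.Nat.ListAction using (sum)
open import Data.Nat.ListAction.Properties using (sum-++)
open import Data.Nat.Logarithm using (⌊log₂_⌋; ⌊log₂⌋-mono-≤; ⌊log₂[2^n]⌋≡n)
open import Data.Nat.Properties
open import Data.Nat.Tactic.RingSolver using (solve-∀)
open import Data.Product.Base using (_×_; _,_; ∃-syntax; proj₁; proj₂)
open import Data.Sum.Base as Sum using (_⊎_; inj₁; inj₂)
open import Data.Unit.Base using (⊤; tt)
open import Data.Vec.Base as Vec using (Vec; []; _∷_; lookup; _[_]≔_; tabulate)
open import Data.Vec.Properties using (∷-injective; tabulate-cong)
open import Data.Vec.Relation.Unary.All as All using (All; []; _∷_)
open import Data.Vec.Relation.Unary.All.Properties using (lookup⁺)
open import Data.Vec.Relation.Unary.AllPairs using ([]; _∷_)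
open import Data.Vec.Relation.Unary.Unique.Propositional using (Unique)
open import Function.Base using (_∘_)
open import Function.Bundles using (Equivalence)
open import Relation.Binary.PropositionalEquality
open import Relation.Nullary.Decidable using (Dec; yes; no; does)
open import Relation.Nullary.Negation using (contradiction)

-- Bit lengths

bits-mono-≤ : ∀ {x y} → x ≤ y → bits x ≤ bits y
bits-mono-≤ x≤y = s≤s (⌊log₂⌋-mono-≤ x≤y)

bits-2^ : ∀ n → bits (2 ^ n) ≡ suc n
bits-2^ n = cong suc (⌊log₂[2^n]⌋≡n n)

x<2^bits : ∀ x → x < 2 ^ bits x
x<2^bits x with x <? 2 ^ bits x
... | yes p = p
... | no ¬p = contradiction
  (subst (_≤ ⌊log₂ x ⌋) (⌊log₂[2^n]⌋≡n (bits x)) (⌊log₂⌋-mono-≤ (≮⇒≥ ¬p)))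
  1+n≰n

bits-* : ∀ x y → bits (x * y) ≤ suc (bits x + bits y)
bits-* x y = subst (bits (x * y) ≤_) (bits-2^ (bits x + bits y)) (bits-mono-≤ (begin
  x * y                     ≤⟨ *-mono-≤ (<⇒≤ (x<2^bits x)) (<⇒≤ (x<2^bits y)) ⟩
  2 ^ bits x * 2 ^ bits y   ≡⟨ ^-distribˡ-+-* 2 (bits x) (bits y) ⟨
  2 ^ (bits x + bits y)     ∎))
  where open ≤-Reasoning

x+y≤x*y : ∀ {x y} → 2 ≤ x → 2 ≤ y → x + y ≤ x * y
x+y≤x*y {suc (suc x)} {suc (suc y)} (s≤s (s≤s _)) (s≤s (s≤s _)) = begin
  2 + x + (2 + y)               ≡⟨ +-comm (2 + x) (2 + y) ⟩
  2 + y + (2 + x)               ≤⟨ +-monoʳ-≤ (2 + y) (m≤n+m (2 + x) y) ⟩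
  2 + y + (y + (2 + x))         ≤⟨ +-monoʳ-≤ (2 + y) (+-mono-≤ (m≤m+n y 0) (+-monoʳ-≤ 2 (m≤m*n x (2 + y)))) ⟩
  2 + y + (y + 0 + (2 + x * (2 + y)))  ≡⟨ cong (2 + y +_) (trans (cong (_+ (2 + x * (2 + y))) (+-identityʳ y)) (trans (sym (+-assoc y 2 (x * (2 + y)))) (cong (_+ x * (2 + y)) (+-comm y 2)))) ⟩
  (2 + x) * (2 + y)             ∎
  where open ≤-Reasoning

bits-+ : ∀ x y → bits (x + y) ≤ suc (bits x + bits y)
bits-+ x y = subst (bits (x + y) ≤_) (bits-2^ (bits x + bits y)) (bits-mono-≤ (begin
  x + y                     ≤⟨ +-mono-≤ (<⇒≤ (x<2^bits x)) (<⇒≤ (x<2^bits y)) ⟩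
  2 ^ bits x + 2 ^ bits y   ≤⟨ x+y≤x*y (2≤2^bits x) (2≤2^bits y) ⟩
  2 ^ bits x * 2 ^ bits y   ≡⟨ ^-distribˡ-+-* 2 (bits x) (bits y) ⟨
  2 ^ (bits x + bits y)     ∎))
  where
  open ≤-Reasoning
  2≤2^bits : ∀ z → 2 ≤ 2 ^ bits z
  2≤2^bits z = ^-monoʳ-≤ 2 {1} {bits z} (s≤s z≤n)

bits-⟦⟧ : ∀ o x y → bits (⟦ o ⟧ x y) ≤ suc (bits x + bits y)
bits-⟦⟧ add   x y       = bits-+ x y
bits-⟦⟧ monus x y       = ≤-trans (bits-mono-≤ (m∸n≤m x y)) (≤-trans (m≤m+n _ _) (n≤1+n _))
bits-⟦⟧ mul   x y       = bits-* x y
bits-⟦⟧ quot  x zero    = s≤s z≤n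
bits-⟦⟧ quot  x (suc y) = ≤-trans (bits-mono-≤ (m/n≤m x (suc y))) (≤-trans (m≤m+n _ _) (n≤1+n _))
bits-⟦⟧ rem   x zero    = ≤-trans (m≤m+n _ _) (n≤1+n _)
bits-⟦⟧ rem   x (suc y) = ≤-trans (bits-mono-≤ (m%n≤m x (suc y))) (≤-trans (m≤m+n _ _) (n≤1+n _))

-- Random access memory

read-write-≡ : ∀ m a v → read (write m a v) a ≡ v
read-write-≡ []      zero    v = refl
read-write-≡ []      (suc a) v = read-write-≡ [] a v
read-write-≡ (x ∷ m) zero    v = refl
read-write-≡ (x ∷ m) (suc a) v = read-write-≡ m a v

read-write-≢ : ∀ m a v {b} → b ≢ a → read (write m a v) b ≡ read m b
read-write-≢ []      zero    v {zero}  b≢a = contradiction refl b≢a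
read-write-≢ []      zero    v {suc b} b≢a = refl
read-write-≢ []      (suc a) v {zero}  b≢a = refl
read-write-≢ []      (suc a) v {suc b} b≢a = read-write-≢ [] a v (λ e → b≢a (cong suc e))
read-write-≢ (x ∷ m) zero    v {zero}  b≢a = contradiction refl b≢a
read-write-≢ (x ∷ m) zero    v {suc b} b≢a = refl
read-write-≢ (x ∷ m) (suc a) v {zero}  b≢a = refl
read-write-≢ (x ∷ m) (suc a) v {suc b} b≢a = read-write-≢ m a v (λ e → b≢a (cong suc e))

write-All : ∀ {P : ℕ → Set} m a {v} → P 0 → P v → LAll.All P m → LAll.All P (write m a v)
write-All []      zero    p0 pv ps       = pv ∷ []
write-All []      (suc a) p0 pv ps       = p0 ∷ write-All [] a p0 pv []
write-All (x ∷ m) zero    p0 pv (px ∷ ps) = pv ∷ ps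
write-All (x ∷ m) (suc a) p0 pv (px ∷ ps) = px ∷ write-All m a p0 pv ps

read-All : ∀ {P : ℕ → Set} m a → P 0 → LAll.All P m → P (read m a)
read-All []      a       p0 ps        = p0
read-All (x ∷ m) zero    p0 (px ∷ ps) = px
read-All (x ∷ m) (suc a) p0 (px ∷ ps) = read-All m a p0 ps

length-write : ∀ m a v {l} → a < l → length m ≤ l → length (write m a v) ≤ l
length-write []      zero    v (s≤s a<l) m≤l       = s≤s z≤n
length-write []      (suc a) v (s≤s a<l) m≤l       = s≤s (length-write [] a v a<l z≤n)
length-write (x ∷ m) zero    v a<l       m≤l       = m≤l
length-write (x ∷ m) (suc a) v (s≤s a<l) (s≤s m≤l) = s≤s (length-write m a v a<l m≤l)

sum-bits≤ : ∀ {b} xs → LAll.All (λ x → bits x ≤ b) xs → sum (List.map bits xs) ≤ length xs * b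
sum-bits≤ []       []       = z≤n
sum-bits≤ (x ∷ xs) (p ∷ ps) = +-mono-≤ p (sum-bits≤ xs ps)

sum-bits-vec≤ : ∀ {b k} (xs : Vec ℕ k) → All (λ x → bits x ≤ b) xs →
                sum (List.map bits (Vec.toList xs)) ≤ k * b
sum-bits-vec≤ []       []       = z≤n
sum-bits-vec≤ (x ∷ xs) (p ∷ ps) = +-mono-≤ p (sum-bits-vec≤ xs ps)

all-[]≔ : ∀ {P : ℕ → Set} {k} (xs : Vec ℕ k) r {v} → All P xs → P v → All P (xs [ r ]≔ v)
all-[]≔ (x ∷ xs) zero    (p ∷ ps) pv = pv ∷ ps
all-[]≔ (x ∷ xs) (suc r) (p ∷ ps) pv = p ∷ all-[]≔ xs r ps pv

-- Costs

module _ {k : ℕ} where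

  -- Depends on the syntax alone: the multiple of `bits X` that bounds the bit length of a value.
  -- Literals contribute their own length because `X` need not bound them.
  valueWeight : Expr k → ℕ
  valueWeight (lit x)      = bits x
  valueWeight (reg r)      = 1
  valueWeight (op o e₁ e₂) = suc (valueWeight e₁ + valueWeight e₂)

  exprWeight : Expr k → ℕ
  exprWeight (lit x)      = bits x
  exprWeight (reg r)      = 1
  exprWeight (op o e₁ e₂) = exprWeight e₁ + exprWeight e₂ + suc (valueWeight e₁ + valueWeight e₂)

  atomWeight : Atom k → ℕ
  atomWeight (set r e)   = suc (exprWeight e)
  atomWeight (load r a)  = suc (exprWeight a + 1)
  atomWeight (store a e) = suc (exprWeight a + exprWeight e)
  atomWeight (query r e) = suc (exprWeight e)

  weight : Cmd k → ℕ
  weight skip          = 1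
  weight (atom a)      = atomWeight a
  weight (c ⨾ c′)      = weight c + weight c′
  weight (cond e c c′) = suc (exprWeight e) + weight c + weight c′
  weight (while e c)   = suc (exprWeight e) + weight c

-- X bounds all numbers stored, L the number of memory cells in use.
module Costed {k : ℕ} (oracle : ℕ → Bool) (X L : ℕ) where

  β : ℕ
  β = bits X

  record Bounded (σ : State k) : Set where
    constructor bounded
    field
      regs≤   : All (_≤ X) (regs σ)
      mem≤    : LAll.All (_≤ X) (mem σ)
      length≤ : length (mem σ) ≤ L

  open Bounded public

  lookup≤ : ∀ {σ} → Bounded σ → ∀ r → lookup (regs σ) r ≤ X
  lookup≤ b r = lookup⁺ (regs≤ b) r

  read≤ : ∀ {σ} → Bounded σ → ∀ a → read (mem σ) a ≤ X
  read≤ {σ} b a = read-All (mem σ) a z≤n (mem≤ b)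

  bits≤value : ∀ {σ} → Bounded σ → ∀ e → bits (eval σ e) ≤ valueWeight e * β
  bits≤value b (lit x) = m≤m*n (bits x) β
  bits≤value b (reg r) = ≤-trans (bits-mono-≤ (lookup≤ b r)) (m≤m+n β 0)
  bits≤value {σ} b (op o e₁ e₂) = begin
    bits (⟦ o ⟧ (eval σ e₁) (eval σ e₂))                  ≤⟨ bits-⟦⟧ o (eval σ e₁) (eval σ e₂) ⟩
    suc (bits (eval σ e₁) + bits (eval σ e₂))             ≤⟨ +-mono-≤ {1} {β} (s≤s z≤n) (+-mono-≤ (bits≤value b e₁) (bits≤value b e₂)) ⟩
    β + (valueWeight e₁ * β + valueWeight e₂ * β)         ≡⟨ cong (β +_) (*-distribʳ-+ β (valueWeight e₁) (valueWeight e₂)) ⟨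
    suc (valueWeight e₁ + valueWeight e₂) * β             ∎
    where open ≤-Reasoning

  exprTime≤ : ∀ {σ} → Bounded σ → ∀ e → exprTime σ e ≤ exprWeight e * β
  exprTime≤ b (lit x) = m≤m*n (bits x) β
  exprTime≤ b (reg r) = ≤-trans (bits-mono-≤ (lookup≤ b r)) (m≤m+n β 0)
  exprTime≤ {σ} b (op o e₁ e₂) = begin
    exprTime σ e₁ + exprTime σ e₂ + bits (eval σ (op o e₁ e₂))
      ≤⟨ +-mono-≤ (+-mono-≤ (exprTime≤ b e₁) (exprTime≤ b e₂)) (bits≤value b (op o e₁ e₂)) ⟩
    exprWeight e₁ * β + exprWeight e₂ * β + v * β
      ≡⟨ cong (_+ v * β) (*-distribʳ-+ β (exprWeight e₁) (exprWeight e₂)) ⟨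
    (exprWeight e₁ + exprWeight e₂) * β + v * β
      ≡⟨ *-distribʳ-+ β (exprWeight e₁ + exprWeight e₂) v ⟨
    (exprWeight e₁ + exprWeight e₂ + v) * β ∎
    where
    open ≤-Reasoning
    v = suc (valueWeight e₁ + valueWeight e₂)

  size≤ : ∀ {σ} → Bounded σ → size σ ≤ (k + L) * β
  size≤ {σ} b = begin
    size σ             ≤⟨ +-mono-≤ (sum-bits-vec≤ (regs σ) (All.map bits-mono-≤ (regs≤ b)))
                                   (≤-trans (sum-bits≤ (mem σ) (LAll.map bits-mono-≤ (mem≤ b))) (*-monoˡ-≤ β (length≤ b))) ⟩
    k * β + L * β      ≡⟨ *-distribʳ-+ β k L ⟨
    (k + L) * β        ∎
    where open ≤-Reasoning

  suc≤ : ∀ {t} w → t ≤ w * β → suc t ≤ suc w * β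
  suc≤ w t≤ = +-mono-≤ {1} {β} (s≤s z≤n) t≤

  +≤ : ∀ {t t′} w w′ → t ≤ w * β → t′ ≤ w′ * β → t + t′ ≤ (w + w′) * β
  +≤ w w′ p p′ = ≤-trans (+-mono-≤ p p′) (≤-reflexive (sym (*-distribʳ-+ β w w′)))

  atomTime≤ : ∀ {σ} → Bounded σ → ∀ a → atomTime oracle a σ ≤ atomWeight a * β
  atomTime≤ b (set r e)   = suc≤ (exprWeight e) (exprTime≤ b e)
  atomTime≤ b (load r a)  = suc≤ (exprWeight a + 1) (+≤ (exprWeight a) 1 (exprTime≤ b a)
                              (≤-trans (bits-mono-≤ (read≤ b _)) (m≤m+n β 0)))
  atomTime≤ b (store a e) = suc≤ (exprWeight a + exprWeight e) (+≤ (exprWeight a) (exprWeight e) (exprTime≤ b a) (exprTime≤ b e))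
  atomTime≤ b (query r e) = suc≤ (exprWeight e) (exprTime≤ b e)

  -- Time is counted in steps; the unit weight c * β is at least the cost of
  -- any atom or test in c, and grows with c, so that sequencing preserves it.
  record Run (c : Cmd k) (σ : State k) (t q : ℕ) (Q : State k → Set) : Set where
    constructor run
    field
      {final} : State k
      {κ}     : Cost
      exec    : Exec oracle c σ final κ
      time≤   : time κ ≤ t * (weight c * β)
      space≤  : space κ ≤ weight c * β + (k + L) * β
      calls≡  : calls κ ≡ q
      final-bounded : Bounded final
      post    : Q final

  run-skip : ∀ {σ Q} → Bounded σ → Q σ → Run skip σ 1 0 Q
  run-skip b p = run skip (s≤s z≤n) (≤-trans (size≤ b) (m≤n+m _ _)) refl b p

  run-atom : ∀ {a σ Q} → Bounded σ → Bounded (effect oracle a σ) → Q (effect oracle a σ) →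
             Run (atom a) σ 1 (atomCalls oracle a) Q
  run-atom {a} b b′ p = run atom
    (≤-trans (atomTime≤ b a) (m≤m+n _ 0))
    (+-mono-≤ (atomTime≤ b a) (⊔-lub (size≤ b) (size≤ b′)))
    refl b′ p

  seq-time : ∀ {t t′} t₁ t₂ w w′ → t ≤ t₁ * (w * β) → t′ ≤ t₂ * (w′ * β) → t + t′ ≤ (t₁ + t₂) * ((w + w′) * β)
  seq-time {t} {t′} t₁ t₂ w w′ p p′ = begin
    t + t′                                         ≤⟨ +-mono-≤ p p′ ⟩
    t₁ * (w * β) + t₂ * (w′ * β)                   ≤⟨ +-mono-≤ (*-monoʳ-≤ t₁ (*-monoˡ-≤ β (m≤m+n w w′))) (*-monoʳ-≤ t₂ (*-monoˡ-≤ β (m≤n+m w′ w))) ⟩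
    t₁ * ((w + w′) * β) + t₂ * ((w + w′) * β)      ≡⟨ *-distribʳ-+ ((w + w′) * β) t₁ t₂ ⟨
    (t₁ + t₂) * ((w + w′) * β)                     ∎
    where open ≤-Reasoning

  widen : ∀ {s S} w {w′} → w ≤ w′ → s ≤ w * β + S → s ≤ w′ * β + S
  widen {S = S} w w≤ p = ≤-trans p (+-monoˡ-≤ S (*-monoˡ-≤ β w≤))

  infixr 5 _▸_

  _▸_ : ∀ {c c′ σ t t′ q q′ Q R} → Run c σ t q Q →
        (∀ {σ′} → Bounded σ′ → Q σ′ → Run c′ σ′ t′ q′ R) →
        Run (c ⨾ c′) σ (t + t′) (q + q′) R
  _▸_ {c} {c′} {t = τ} {τ′} (run x t s q b p) h with h b p
  ... | run x′ t′ s′ q′ b′ p′ = run (x ⨾ x′)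
    (seq-time τ τ′ (weight c) (weight c′) t t′)
    (⊔-lub (widen (weight c) (m≤m+n _ _) s) (widen (weight c′) (m≤n+m _ (weight c)) s′))
    (cong₂ _+_ q q′) b′ p′

  run-time : ∀ {c σ t t′ q Q} → t ≤ t′ → Run c σ t q Q → Run c σ t′ q Q
  run-time {c} t≤ (run x t s q b p) = run x (≤-trans t (*-monoˡ-≤ (weight c * β) t≤)) s q b p

  run-post : ∀ {c σ t q Q R} → (∀ {σ′} → Q σ′ → R σ′) → Run c σ t q Q → Run c σ t q R
  run-post f (run x t s q b p) = run x t s q b (f p)

  set-bounded : ∀ {σ} → Bounded σ → ∀ {r e} → eval σ e ≤ X → Bounded (effect oracle (set r e) σ)
  set-bounded {σ} (bounded r m l) {r = i} v = bounded (all-[]≔ (regs σ) i r v) m l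

  query-bounded : ∀ {σ} → Bounded σ → ∀ {r e} → 1 ≤ X → Bounded (effect oracle (query r e) σ)
  query-bounded {σ} (bounded r m l) {i} {e} 1≤X = bounded (all-[]≔ (regs σ) i r (answer≤ (oracle (eval σ e)))) m l
    where
    answer≤ : ∀ b → (if b then 1 else 0) ≤ X
    answer≤ true  = 1≤X
    answer≤ false = z≤n

  -- In this rule and the next three the intermediate state is pinned down by an equation, so the
  -- rest of the program is analysed on a concrete state and its side conditions reduce by
  -- evaluation.
  run-set : ∀ {r e c σ t q Q} → Bounded σ → eval σ e ≤ X →
            (Bounded (effect oracle (set r e) σ) → Run c (effect oracle (set r e) σ) t q Q) →
            Run (atom (set r e) ⨾ c) σ (suc t) q Q
  run-set {r} {e} {σ = σ} b v h =
    run-atom {Q = _≡ effect oracle (set r e) σ} b (set-bounded b {r} {e} v) refl ▸ λ { b′ refl → h b′ }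

  run-load : ∀ {r e c σ t q Q} → Bounded σ →
             (Bounded (effect oracle (load r e) σ) → Run c (effect oracle (load r e) σ) t q Q) →
             Run (atom (load r e) ⨾ c) σ (suc t) q Q
  run-load {r} {e} {σ = σ} b@(bounded rs m l) h =
    run-atom {Q = _≡ effect oracle (load r e) σ} b (bounded (all-[]≔ (regs σ) r rs (read≤ b (eval σ e))) m l) refl ▸ λ { b′ refl → h b′ }

  run-store : ∀ {a e c σ t q Q} → Bounded σ → eval σ a < L → eval σ e ≤ X →
              (Bounded (effect oracle (store a e) σ) → Run c (effect oracle (store a e) σ) t q Q) →
              Run (atom (store a e) ⨾ c) σ (suc t) q Q
  run-store {a} {e} {σ = σ} b@(bounded rs m l) a<L v h =
    run-atom {Q = _≡ effect oracle (store a e) σ} b (bounded rs (write-All (mem σ) (eval σ a) z≤n v m) (length-write (mem σ) (eval σ a) (eval σ e) a<L l)) refl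
      ▸ λ { b′ refl → h b′ }

  run-query : ∀ {r e c σ t q Q} → Bounded σ → 1 ≤ X →
              (Bounded (effect oracle (query r e) σ) → Run c (effect oracle (query r e) σ) t q Q) →
              Run (atom (query r e) ⨾ c) σ (suc t) (suc q) Q
  run-query {r} {e} {σ = σ} b 1≤X h =
    run-atom {Q = _≡ effect oracle (query r e) σ} b (query-bounded b {r} {e} 1≤X) refl ▸ λ { b′ refl → h b′ }

  run-last : ∀ {r e σ} {Q : State k → Set} → Bounded σ → eval σ e ≤ X → Q (effect oracle (set r e) σ) → Run (atom (set r e)) σ 1 0 Q
  run-last {r} {e} b v p = run-atom b (set-bounded b {r} {e} v) p

  -- One unit per iteration pays for its test, and the final 1 for the test that fails.
  loopTime : ℕ → ℕ → ℕ
  loopTime M t = M * suc t + 1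

  -- I i is the loop invariant before the (i+1)-st iteration.
  run-while : ∀ {e c σ t q} (I : ℕ → State k → Set) j M {i} → i + j ≡ M →
    (∀ i {σ} → i < M → Bounded σ → I i σ → eval σ e ≢ 0 × Run c σ t q (I (suc i))) →
    (∀ {σ} → Bounded σ → I M σ → eval σ e ≡ 0) →
    Bounded σ → I i σ → Run (while e c) σ (loopTime j t) (j * q) (I M)
  run-while {e} {c} {σ} {t} {q} I zero M {i} eq body exit b p with trans (sym (+-identityʳ i)) eq
  ... | refl = run (while-false (exit b p))
    (≤-trans (suc≤ (exprWeight e) (exprTime≤ b e)) (≤-trans (*-monoˡ-≤ β (m≤m+n (suc (exprWeight e)) (weight c))) (m≤m+n _ 0)))
    (+-mono-≤ (≤-trans (suc≤ (exprWeight e) (exprTime≤ b e)) (*-monoˡ-≤ β (m≤m+n (suc (exprWeight e)) (weight c)))) (size≤ b))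
    refl b p
  run-while {e} {c} {σ} {t} {q} I (suc j) M {i} eq body exit b p
    with body i (subst (i <_) eq (m<m+n i z<s)) b p
  ... | nz , run x₁ t₁ s₁ q₁ b₁ p₁
    with run-while I j M (trans (sym (+-suc i j)) eq) body exit b₁ p₁
  ... | run x₂ t₂ s₂ q₂ b₂ p₂ = run (while-true nz x₁ x₂)
    (begin
      _ ≤⟨ +-mono-≤ test≤ (+-mono-≤ (≤-trans t₁ (*-monoʳ-≤ t (*-monoˡ-≤ β (m≤n+m _ w)))) t₂) ⟩
      W + (t * W + loopTime j t * W)      ≡⟨ cong (W +_) (*-distribʳ-+ W t (loopTime j t)) ⟨
      (1 + (t + loopTime j t)) * W        ≡⟨ cong (λ z → suc z * W) (+-assoc t (j * suc t) 1) ⟨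
      loopTime (suc j) t * W              ∎)
    (⊔-lub (+-mono-≤ test≤ (size≤ b)) (⊔-lub (widen (weight c) (m≤n+m _ w) s₁) s₂))
    (cong₂ _+_ q₁ q₂) b₂ p₂
    where
    open ≤-Reasoning
    w = suc (exprWeight e)
    W = (w + weight c) * β
    test≤ : suc (exprTime σ e) ≤ W
    test≤ = ≤-trans (suc≤ (exprWeight e) (exprTime≤ b e)) (*-monoˡ-≤ β (m≤m+n w (weight c)))

  run-while₀ : ∀ {e c σ t} (I : ℕ → State k → Set) M →
    (∀ i {σ} → i < M → Bounded σ → I i σ → eval σ e ≢ 0 × Run c σ t 0 (I (suc i))) →
    (∀ {σ} → Bounded σ → I M σ → eval σ e ≡ 0) →
    Bounded σ → I 0 σ → Run (while e c) σ (loopTime M t) 0 (I M)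
  run-while₀ {e} {c} {σ} {t} I M body exit b p =
    subst (λ q → Run (while e c) σ (loopTime M t) q (I M)) (*-zeroʳ M) (run-while I M M refl body exit b p)

-- Division

infixl 7 _÷_ _mod_

-- These are the machine operations themselves, with `x ÷ 0 = 0` and `x mod 0 = x`, so that the
-- formulas below agree with evaluated program expressions by computation.
_÷_ _mod_ : ℕ → ℕ → ℕ
_÷_   = ⟦ quot ⟧
_mod_ = ⟦ rem ⟧

mod-+ : ∀ N {l} q → l < N → (l + N * q) mod N ≡ l
mod-+ (suc N) {l} q l<N = trans (cong (λ z → (l + z) % suc N) (*-comm (suc N) q))
  (trans ([m+kn]%n≡m%n l q (suc N)) (m<n⇒m%n≡m l<N))

decompose : ∀ N x → 0 < N → x ≡ x mod N + N * (x ÷ N)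
decompose (suc N) x _ = trans (m≡m%n+[m/n]*n x (suc N)) (cong (x % suc N +_) (*-comm (x / suc N) (suc N)))

mod-< : ∀ N x → 0 < N → x mod N < N
mod-< (suc N) x _ = m%n<n x (suc N)

div-+ : ∀ N {l} q → l < N → (l + N * q) ÷ N ≡ q
div-+ (suc N) {l} q l<N = *-cancelˡ-≡ ((l + suc N * q) ÷ suc N) q (suc N) (+-cancelˡ-≡ l _ _ (begin
  l + suc N * ((l + suc N * q) ÷ suc N)                         ≡⟨ cong (_+ suc N * ((l + suc N * q) ÷ suc N)) (mod-+ (suc N) q l<N) ⟨
  (l + suc N * q) mod suc N + suc N * ((l + suc N * q) ÷ suc N) ≡⟨ decompose (suc N) (l + suc N * q) z<s ⟨
  l + suc N * q ∎))
  where open ≡-Reasoning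

÷-≤ : ∀ x N → x ÷ N ≤ x
÷-≤ x zero    = z≤n
÷-≤ x (suc N) = m/n≤m x (suc N)

mod-≤ : ∀ x N → x mod N ≤ x
mod-≤ x zero    = ≤-refl
mod-≤ x (suc N) = m%n≤m x (suc N)

÷-< : ∀ N M x → x < M * N → x ÷ N < M
÷-< zero    M x x< = contradiction (subst (x <_) (*-zeroʳ M) x<) λ ()
÷-< (suc N) M x x< = m<n*o⇒m/o<n x<

÷-self : ∀ {x N} → x < N → x ÷ N ≡ 0
÷-self {x} {suc N} x< = m<n⇒m/n≡0 x<

+-*-< : ∀ N M {l q} → l < N → q < M → l + N * q < N * M
+-*-< N M {l} {q} l<N q<M = begin-strict
  l + N * q     <⟨ +-monoˡ-< (N * q) l<N ⟩
  N + N * q     ≡⟨ *-suc N q ⟨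
  N * suc q     ≤⟨ *-monoʳ-≤ N q<M ⟩
  N * M         ∎
  where open ≤-Reasoning

-- If `b < a`, a low part below `N` cannot make up for the missing `N`. This is how an inequality
-- between packed values yields one between the quantities being maximized.
packed-≤ : ∀ N {a b k l} → l < N → k + N * a ≤ l + N * b → a ≤ b
packed-≤ N {a} {b} {k} {l} l<N p = ≮⇒≥ λ b<a → <-irrefl refl (begin-strict
  l + N * b   <⟨ +-*-< N a l<N b<a ⟩
  N * a       ≤⟨ m≤n+m (N * a) k ⟩
  k + N * a   ≤⟨ p ⟩
  l + N * b   ∎)
  where open ≤-Reasoning

0<2^ : ∀ i → 0 < 2 ^ i
0<2^ i = m^n>0 2 i

-- Dividing by 2 first and by `p` afterwards reduces statements about digit `suc i` of `x` to digit
-- `i` of `x / 2`, the induction used throughout the next section.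
mod-2* : ∀ p x → 0 < p → x mod (2 * p) ≡ x % 2 + 2 * ((x / 2) mod p) × x ÷ (2 * p) ≡ (x / 2) ÷ p
mod-2* p x 0<p = trans (cong (_mod (2 * p)) eq) (mod-+ (2 * p) ((x / 2) ÷ p) l<) ,
                 trans (cong (_÷ (2 * p)) eq) (div-+ (2 * p) ((x / 2) ÷ p) l<)
  where
  l = x % 2 + 2 * ((x / 2) mod p)
  l< : l < 2 * p
  l< = +-*-< 2 p (m%n<n x 2) (mod-< p (x / 2) 0<p)
  regroup : ∀ a b c p → a + 2 * (b + p * c) ≡ a + 2 * b + 2 * p * c
  regroup = solve-∀
  eq : x ≡ l + 2 * p * ((x / 2) ÷ p)
  eq = trans (decompose 2 x z<s)
    (trans (cong (λ z → x % 2 + 2 * z) (decompose p (x / 2) 0<p))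
           (regroup (x % 2) ((x / 2) mod p) ((x / 2) ÷ p) p))

÷-2^suc : ∀ i x → x ÷ 2 ^ suc i ≡ (x / 2) ÷ 2 ^ i
÷-2^suc i x = proj₂ (mod-2* (2 ^ i) x (0<2^ i))

-- Flipping a binary digit

-- Adds 1 to an even number and subtracts 1 from an odd one, by arithmetic that the machine offers;
-- `cellC` evaluates the same formula.
flip : ℕ → ℕ
flip q = q + 1 ∸ 2 * (q % 2)

-- For p = 2ⁱ, inverts digit i of x.
neighbour : ℕ → ℕ → ℕ
neighbour p x = x mod p + p * flip (x ÷ p)

data Parity (q : ℕ) : Set where
  even : ∀ h → q ≡ 0 + 2 * h → flip q ≡ 1 + 2 * h → Parity q
  odd  : ∀ h → q ≡ 1 + 2 * h → flip q ≡ 0 + 2 * h → Parity q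

parity : ∀ q → Parity q
parity q with q % 2 in r | m%n<n q 2 | decompose 2 q z<s
... | 0 | _ | eq = even (q / 2) eq (trans (cong (λ z → q + 1 ∸ 2 * z) r) (trans (+-comm q 1) (cong suc eq)))
... | 1 | _ | eq = odd (q / 2) eq (trans (cong (λ z → q + 1 ∸ 2 * z) r)
  (trans (cong (λ z → z + 1 ∸ 2) eq) (cong (_∸ 1) (+-comm (2 * (q / 2)) 1))))
... | suc (suc _) | s≤s (s≤s ()) | _

half : ∀ {q l} h → l < 2 → q ≡ l + 2 * h → q / 2 ≡ h
half {l = l} h l<2 refl = div-+ 2 h l<2

low : ∀ {q l} h → l < 2 → q ≡ l + 2 * h → q % 2 ≡ l
low {l = l} h l<2 refl = mod-+ 2 h l<2

flip-/2 : ∀ q → flip q / 2 ≡ q / 2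
flip-/2 q with parity q
... | even h e e′ = trans (half h (s≤s (s≤s z≤n)) e′) (sym (half h (s≤s z≤n) e))
... | odd h e e′  = trans (half h (s≤s z≤n) e′) (sym (half h (s≤s (s≤s z≤n)) e))

flip-%2 : ∀ q → flip q % 2 ≢ q % 2
flip-%2 q eq with parity q
... | even h e e′ = contradiction (trans (sym (low h (s≤s (s≤s z≤n)) e′)) (trans eq (low h (s≤s z≤n) e))) λ ()
... | odd h e e′  = contradiction (trans (sym (low h (s≤s z≤n) e′)) (trans eq (low h (s≤s (s≤s z≤n)) e))) λ ()

flip-or-≡ : ∀ q r → r / 2 ≡ q / 2 → r ≡ q ⊎ r ≡ flip q
flip-or-≡ q r eq with parity q | parity r
... | even h e e′ | even k d _ rewrite half h (s≤s z≤n) e | half k (s≤s z≤n) d | eq = inj₁ (trans d (sym e))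
... | even h e e′ | odd k d _ rewrite half h (s≤s z≤n) e | half k (s≤s (s≤s z≤n)) d | eq = inj₂ (trans d (sym e′))
... | odd h e e′ | even k d _ rewrite half h (s≤s (s≤s z≤n)) e | half k (s≤s z≤n) d | eq = inj₂ (trans d (sym e′))
... | odd h e e′ | odd k d _ rewrite half h (s≤s (s≤s z≤n)) e | half k (s≤s (s≤s z≤n)) d | eq = inj₁ (trans d (sym e))

neighbour-zero : ∀ x → neighbour 1 x ≡ flip x
neighbour-zero x = trans (cong₂ (λ a b → a + (flip b + 0)) (n<1⇒n≡0 (mod-< 1 x z<s)) (n/1≡n x)) (+-identityʳ (flip x))

neighbour-suc : ∀ i x → neighbour (2 ^ suc i) x ≡ x % 2 + 2 * neighbour (2 ^ i) (x / 2)
neighbour-suc i x = trans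
  (cong₂ (λ a b → a + 2 * p * flip b) (proj₁ (mod-2* p x (0<2^ i))) (÷-2^suc i x))
  (regroup (x % 2) ((x / 2) mod p) (flip ((x / 2) ÷ p)) p)
  where
  p = 2 ^ i
  regroup : ∀ a b c p → a + 2 * b + 2 * p * c ≡ a + 2 * (b + p * c)
  regroup = solve-∀

neighbour-÷ : ∀ i x → neighbour (2 ^ i) x ÷ 2 ^ i ≡ flip (x ÷ 2 ^ i)
neighbour-÷ i x = div-+ (2 ^ i) (flip (x ÷ 2 ^ i)) (mod-< (2 ^ i) x (0<2^ i))

/2-< : ∀ {x M} → x < 2 * M → x / 2 < M
/2-< {x} {M} x< = ÷-< 2 M x (subst (x <_) (*-comm 2 M) x<)

<-2* : ∀ {x} M → x / 2 < M → x < 2 * M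
<-2* {x} M x< = subst (_< 2 * M) (sym (decompose 2 x z<s)) (+-*-< 2 M (m%n<n x 2) x<)

neighbour-< : ∀ {n i x} → i < n → x < 2 ^ n → neighbour (2 ^ i) x < 2 ^ n
neighbour-< {suc n} {zero} {x} _ x< =
  subst (_< 2 ^ suc n) (sym (neighbour-zero x)) (<-2* (2 ^ n) (subst (_< 2 ^ n) (sym (flip-/2 x)) (/2-< x<)))
neighbour-< {suc n} {suc i} {x} (s≤s i<n) x< =
  subst (_< 2 ^ suc n) (sym (neighbour-suc i x)) (+-*-< 2 (2 ^ n) (m%n<n x 2) (neighbour-< {n} {i} i<n (/2-< x<)))

-- A block of length `2 ^ suc i` consists of two blocks of length `2 ^ i`, which the inversion of
-- digit `i` exchanges.
block-split : ∀ i x y → x ÷ 2 ^ suc i ≡ y ÷ 2 ^ suc i →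
              x ÷ 2 ^ i ≡ y ÷ 2 ^ i ⊎ neighbour (2 ^ i) x ÷ 2 ^ i ≡ y ÷ 2 ^ i
block-split zero x y eq with flip-or-≡ x y (trans (sym (n/1≡n (y / 2))) (trans (sym (÷-2^suc 0 y)) (trans (sym eq) (trans (÷-2^suc 0 x) (n/1≡n (x / 2))))))
... | inj₁ refl = inj₁ refl
... | inj₂ refl = inj₂ (cong (_/ 1) (neighbour-zero x))
block-split (suc i) x y eq
  with block-split i (x / 2) (y / 2) (trans (sym (÷-2^suc (suc i) x)) (trans eq (÷-2^suc (suc i) y)))
... | inj₁ e = inj₁ (trans (÷-2^suc i x) (trans e (sym (÷-2^suc i y))))
... | inj₂ e = inj₂ (trans (÷-2^suc i _)
  (trans (cong (_÷ 2 ^ i) (half _ (m%n<n x 2) (neighbour-suc i x))) (trans e (sym (÷-2^suc i y)))))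

block-mono : ∀ i x y → x ÷ 2 ^ i ≡ y ÷ 2 ^ i → x ÷ 2 ^ suc i ≡ y ÷ 2 ^ suc i
block-mono zero x y eq = cong (_÷ 2) (trans (sym (n/1≡n x)) (trans eq (n/1≡n y)))
block-mono (suc i) x y eq = trans (÷-2^suc (suc i) x) (trans
  (block-mono i (x / 2) (y / 2) (trans (sym (÷-2^suc i x)) (trans eq (÷-2^suc i y))))
  (sym (÷-2^suc (suc i) y)))

neighbour-block : ∀ i x → neighbour (2 ^ i) x ÷ 2 ^ suc i ≡ x ÷ 2 ^ suc i
neighbour-block zero x = trans (cong (_÷ 2) (neighbour-zero x)) (flip-/2 x)
neighbour-block (suc i) x = trans (÷-2^suc (suc i) _)
  (trans (cong (_÷ 2 ^ suc i) (half _ (m%n<n x 2) (neighbour-suc i x)))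
  (trans (neighbour-block i (x / 2)) (sym (÷-2^suc (suc i) x))))

-- Digit `i` tells them apart: it is the lowest digit of the quotients by `2 ^ i`.
neighbour-≢ : ∀ i x y → neighbour (2 ^ i) x ÷ 2 ^ i ≡ y ÷ 2 ^ i → x ≢ y
neighbour-≢ i x .x eq refl = flip-%2 (x ÷ 2 ^ i) (cong (_% 2) (trans (sym (neighbour-÷ i x)) eq))

-- Points and their codes

δ : ∀ n → ℕ → ℕ → ℕ
δ n x y = d_H (toPoint n x) (toPoint n y)

-- Exclusive or of the lowest digits, in the form in which `distC` adds it up.
digit : ℕ → ℕ → ℕ
digit x y = (x % 2 + y % 2) % 2

digit-spec : ∀ x y → (if does ((x % 2 ≡ᵇ 1) ≟ᵇ (y % 2 ≡ᵇ 1)) then 0 else 1) ≡ digit x y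
digit-spec x y with x % 2 | m%n<n x 2 | y % 2 | m%n<n y 2
... | 0 | _ | 0 | _ = refl
... | 0 | _ | 1 | _ = refl
... | 1 | _ | 0 | _ = refl
... | 1 | _ | 1 | _ = refl
... | suc (suc _) | s≤s (s≤s ()) | _ | _
... | _ | _ | suc (suc _) | s≤s (s≤s ())

digit-≢ : ∀ x y → x % 2 ≢ y % 2 → digit x y ≡ 1
digit-≢ x y x≢y with x % 2 | m%n<n x 2 | y % 2 | m%n<n y 2
... | 0 | _ | 0 | _ = contradiction refl x≢y
... | 0 | _ | 1 | _ = refl
... | 1 | _ | 0 | _ = refl
... | 1 | _ | 1 | _ = contradiction refl x≢y
... | suc (suc _) | s≤s (s≤s ()) | _ | _
... | _ | _ | suc (suc _) | s≤s (s≤s ())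

digit-≡ : ∀ x y → x % 2 ≡ y % 2 → digit x y ≡ 0
digit-≡ x y x≡y rewrite x≡y with y % 2 | m%n<n y 2
... | 0 | _ = refl
... | 1 | _ = refl
... | suc (suc _) | s≤s (s≤s ())

δ-suc : ∀ n x y → δ (suc n) x y ≡ digit x y + δ n (x / 2) (y / 2)
δ-suc n x y = cong (_+ δ n (x / 2) (y / 2)) (digit-spec x y)

-- From digit `i` upwards `y` agrees with the neighbour, so `x` differs from `y` in digit `i` and
-- the neighbour does not; in all other digits `x` and its neighbour coincide. Hence a round can add
-- exactly 1, whatever `y` is.
δ-neighbour : ∀ {n} i x y → i < n → neighbour (2 ^ i) x ÷ 2 ^ i ≡ y ÷ 2 ^ i →
              δ n x y ≡ suc (δ n (neighbour (2 ^ i) x) y)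
δ-neighbour {suc n} zero x y _ eq = begin
  δ (suc n) x y                              ≡⟨ δ-suc n x y ⟩
  digit x y + δ n (x / 2) (y / 2)            ≡⟨ cong₂ (λ a b → a + δ n b (y / 2)) (digit-≢ x y x≢y) (trans (sym (flip-/2 x)) (cong (_/ 2) flip≡y)) ⟩
  suc (δ n (y / 2) (y / 2))                  ≡⟨ cong suc (cong (_+ δ n (y / 2) (y / 2)) (digit-≡ y y refl)) ⟨
  suc (digit y y + δ n (y / 2) (y / 2))      ≡⟨ cong suc (δ-suc n y y) ⟨
  suc (δ (suc n) y y)                        ≡⟨ cong (λ z → suc (δ (suc n) z y)) n≡y ⟨
  suc (δ (suc n) (neighbour 1 x) y)          ∎
  where
  open ≡-Reasoning
  n≡y : neighbour 1 x ≡ y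
  n≡y = trans (sym (n/1≡n (neighbour 1 x))) (trans eq (n/1≡n y))
  flip≡y : flip x ≡ y
  flip≡y = trans (sym (neighbour-zero x)) n≡y
  x≢y : x % 2 ≢ y % 2
  x≢y e = flip-%2 x (trans (cong (_% 2) flip≡y) (sym e))
δ-neighbour {suc n} (suc i) x y (s≤s i<n) eq = begin
  δ (suc n) x y                              ≡⟨ δ-suc n x y ⟩
  digit x y + δ n (x / 2) (y / 2)            ≡⟨ cong (digit x y +_) (δ-neighbour i (x / 2) (y / 2) i<n eq′) ⟩
  digit x y + suc (δ n m (y / 2))            ≡⟨ +-suc (digit x y) _ ⟩
  suc (digit x y + δ n m (y / 2))            ≡⟨ cong₂ (λ a b → suc ((a + y % 2) % 2 + δ n b (y / 2))) (low m (m%n<n x 2) (neighbour-suc i x)) m≡ ⟨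
  suc (digit x′ y + δ n (x′ / 2) (y / 2))    ≡⟨ cong suc (δ-suc n x′ y) ⟨
  suc (δ (suc n) x′ y)                       ∎
  where
  open ≡-Reasoning
  m  = neighbour (2 ^ i) (x / 2)
  x′ = neighbour (2 ^ suc i) x
  m≡ : x′ / 2 ≡ m
  m≡ = half m (m%n<n x 2) (neighbour-suc i x)
  eq′ : m ÷ 2 ^ i ≡ (y / 2) ÷ 2 ^ i
  eq′ = trans (cong (_÷ 2 ^ i) (sym m≡)) (trans (sym (÷-2^suc i x′)) (trans eq (÷-2^suc i y)))

toPoint-+ : ∀ n x k → toPoint n (x + 2 ^ n * k) ≡ toPoint n x
toPoint-+ zero    x k = refl
toPoint-+ (suc n) x k = cong₂ (λ a b → (a ≡ᵇ 1) ∷ b) (low (x / 2 + 2 ^ n * k) (m%n<n x 2) eq)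
  (trans (cong (toPoint n) (half (x / 2 + 2 ^ n * k) (m%n<n x 2) eq)) (toPoint-+ n (x / 2) k))
  where
  regroup : ∀ a b p k → a + 2 * b + 2 * p * k ≡ a + 2 * (b + p * k)
  regroup = solve-∀
  eq : x + 2 ^ suc n * k ≡ x % 2 + 2 * (x / 2 + 2 ^ n * k)
  eq = trans (cong (_+ 2 ^ suc n * k) (decompose 2 x z<s)) (regroup (x % 2) (x / 2) (2 ^ n) k)

toPoint-mod : ∀ n x → toPoint n (x mod 2 ^ n) ≡ toPoint n x
toPoint-mod n x = trans (sym (toPoint-+ n (x mod 2 ^ n) (x ÷ 2 ^ n))) (cong (toPoint n) (sym (decompose (2 ^ n) x (0<2^ n))))

toPoint-injective : ∀ n {x y} → x < 2 ^ n → y < 2 ^ n → toPoint n x ≡ toPoint n y → x ≡ y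
toPoint-injective zero    x< y< eq = trans (n<1⇒n≡0 x<) (sym (n<1⇒n≡0 y<))
toPoint-injective (suc n) {x} {y} x< y< eq with ∷-injective eq
... | e , es = trans (decompose 2 x z<s) (trans
  (cong₂ (λ a b → a + 2 * b) (low≡ (m%n<n x 2) (m%n<n y 2) e) (toPoint-injective n (/2-< x<) (/2-< y<) es))
  (sym (decompose 2 y z<s)))
  where
  low≡ : ∀ {a b} → a < 2 → b < 2 → (a ≡ᵇ 1) ≡ (b ≡ᵇ 1) → a ≡ b
  low≡ {0} {0} _ _ _ = refl
  low≡ {1} {1} _ _ _ = refl
  low≡ {suc (suc _)} (s≤s (s≤s ())) _ _
  low≡ {_} {suc (suc _)} _ (s≤s (s≤s ())) _

fromPoint : ∀ {n} → Point n → ℕ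
fromPoint []       = 0
fromPoint (b ∷ bs) = (if b then 1 else 0) + 2 * fromPoint bs

bit<2 : ∀ b → (if b then 1 else 0) < 2
bit<2 true  = s≤s (s≤s z≤n)
bit<2 false = s≤s z≤n

fromPoint-< : ∀ {n} (z : Point n) → fromPoint z < 2 ^ n
fromPoint-< []           = s≤s z≤n
fromPoint-< {suc n} (b ∷ bs) = +-*-< 2 (2 ^ n) (bit<2 b) (fromPoint-< bs)

toPoint-fromPoint : ∀ {n} (z : Point n) → toPoint n (fromPoint z) ≡ z
toPoint-fromPoint []       = refl
toPoint-fromPoint {suc n} (b ∷ bs) = cong₂ _∷_
  (trans (cong (_≡ᵇ 1) (low (fromPoint bs) (bit<2 b) refl)) (bit b))
  (trans (cong (toPoint n) (half (fromPoint bs) (bit<2 b) refl)) (toPoint-fromPoint bs))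
  where
  bit : ∀ b → ((if b then 1 else 0) ≡ᵇ 1) ≡ b
  bit true  = refl
  bit false = refl

decode : ∀ n m → ℕ → Vec (Point n) m
decode n zero    u = []
decode n (suc m) u = toPoint n u ∷ decode n m (u ÷ 2 ^ n)

encode : ∀ {n m} → Vec (Point n) m → ℕ
encode []           = 0
encode {n} (z ∷ zs) = fromPoint z + 2 ^ n * encode zs

decode-+ : ∀ n m x u → x < 2 ^ n → decode n (suc m) (x + 2 ^ n * u) ≡ toPoint n x ∷ decode n m u
decode-+ n m x u x< = cong₂ _∷_ (toPoint-+ n x u) (cong (decode n m) (div-+ (2 ^ n) u x<))

-- Digits from the `m`-th on are ignored, so a threshold may be stored above the points in the same
-- number.
decode-+* : ∀ n m u k → decode n m (u + (2 ^ n) ^ m * k) ≡ decode n m u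
decode-+* n zero    u k = refl
decode-+* n (suc m) u k = cong₂ _∷_
  (trans (cong (toPoint n) (cong (u +_) (*-assoc N (N ^ m) k))) (toPoint-+ n u (N ^ m * k)))
  (trans (cong (decode n m) (trans (cong (_÷ N) eq) (div-+ N (u ÷ N + N ^ m * k) (mod-< N u (0<2^ n))))) (decode-+* n m (u ÷ N) k))
  where
  N = 2 ^ n
  regroup : ∀ a b c N k → a + N * b + N * c * k ≡ a + N * (b + c * k)
  regroup = solve-∀
  eq : u + N * N ^ m * k ≡ u mod N + N * (u ÷ N + N ^ m * k)
  eq = trans (cong (_+ N * N ^ m * k) (decompose N u (0<2^ n))) (regroup (u mod N) (u ÷ N) (N ^ m) N k)

decode-encode : ∀ {n m} (zs : Vec (Point n) m) → decode n m (encode zs) ≡ zs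
decode-encode []           = refl
decode-encode {n} {suc m} (z ∷ zs) = trans (decode-+ n m (fromPoint z) (encode zs) (fromPoint-< z))
  (cong₂ _∷_ (toPoint-fromPoint z) (decode-encode zs))

encode-< : ∀ {n m} (zs : Vec (Point n) m) → encode zs < (2 ^ n) ^ m
encode-< []           = s≤s z≤n
encode-< {n} {suc m} (z ∷ zs) = +-*-< (2 ^ n) ((2 ^ n) ^ m) (fromPoint-< z) (encode-< zs)

-- Distances

d_H-≤ : ∀ {n} (x y : Point n) → d_H x y ≤ n
d_H-≤ []       []       = z≤n
d_H-≤ (a ∷ as) (b ∷ bs) with does (a ≟ᵇ b)
... | true  = ≤-trans (d_H-≤ as bs) (n≤1+n _)
... | false = s≤s (d_H-≤ as bs)

d_H-refl : ∀ {n} (x : Point n) → d_H x x ≡ 0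
d_H-refl []          = refl
d_H-refl (true ∷ as)  = d_H-refl as
d_H-refl (false ∷ as) = d_H-refl as

d_H≡0⇒≡ : ∀ {n} (x y : Point n) → d_H x y ≡ 0 → x ≡ y
d_H≡0⇒≡ []           []           _  = refl
d_H≡0⇒≡ (true ∷ as)  (true ∷ bs)  eq = cong (true ∷_) (d_H≡0⇒≡ as bs eq)
d_H≡0⇒≡ (false ∷ as) (false ∷ bs) eq = cong (false ∷_) (d_H≡0⇒≡ as bs eq)

distances : ∀ {n m} → Point n → Vec (Point n) m → ℕ
distances z []       = 0
distances z (y ∷ ys) = d_H z y + distances z ys

sumPD-∷ : ∀ {n m} (z : Point n) (zs : Vec (Point n) m) → sumPD (z ∷ zs) ≡ distances z zs + sumPD zs
sumPD-∷ z zs = trans (sum-++ (Vec.toList (Vec.map (d_H z) zs)) (pairDistances zs))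
  (cong (_+ sumPD zs) (sum-distances zs))
  where
  sum-distances : ∀ {m} (ys : Vec _ m) → sum (Vec.toList (Vec.map (d_H z) ys)) ≡ distances z ys
  sum-distances []       = refl
  sum-distances (y ∷ ys) = cong (d_H z y +_) (sum-distances ys)

distances-≤ : ∀ {n m} (z : Point n) (zs : Vec (Point n) m) → distances z zs ≤ m * n
distances-≤ z []       = z≤n
distances-≤ z (y ∷ ys) = +-mono-≤ (d_H-≤ z y) (distances-≤ z ys)

sumPD-≤ : ∀ {n m} (zs : Vec (Point n) m) → sumPD zs ≤ m * m * n
sumPD-≤ []       = z≤n
sumPD-≤ {n} {suc m} (z ∷ zs) = begin
  sumPD (z ∷ zs)             ≡⟨ sumPD-∷ z zs ⟩
  distances z zs + sumPD zs  ≤⟨ +-mono-≤ (distances-≤ z zs) (sumPD-≤ zs) ⟩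
  m * n + m * m * n          ≤⟨ m≤m+n _ (n + m * n) ⟩
  m * n + m * m * n + (n + m * n) ≡⟨ regroup m n ⟩
  suc m * suc m * n          ∎
  where
  open ≤-Reasoning
  regroup : ∀ m n → m * n + m * m * n + (n + m * n) ≡ suc m * suc m * n
  regroup = solve-∀

-- D-scattered tuples of solutions

module _ {n : ℕ} (f : Point n → Bool) (D : ℕ) where

  Full : ∀ {m} → Vec (Point n) m → Set
  Full []       = ⊤
  Full (z ∷ zs) = f z ≡ true × All (λ y → D ≤ d_H z y) zs × Full zs

  -- The term `1 ∸ (D ∸ d)` is the indicator of `D ≤ d`, free of case distinctions.
  farCount : ∀ {m} → Point n → Vec (Point n) m → ℕ
  farCount z []       = 0
  farCount z (y ∷ ys) = (1 ∸ (D ∸ d_H z y)) + farCount z ys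

  -- The number of constraints satisfied. It turns `Full` into the attainment of a maximum, which a
  -- numerical objective can enforce.
  count : ∀ {m} → Vec (Point n) m → ℕ
  count []       = 0
  count (z ∷ zs) = (if f z then 1 else 0) + (farCount z zs + count zs)

-- There are `m` membership constraints and one for each pair, `m (m + 1) / 2` in all; the summands
-- are grouped as in `count`, ready for `+-tight`.
maxCount : ℕ → ℕ
maxCount zero    = 0
maxCount (suc m) = 1 + (m + maxCount m)

+-tight : ∀ {a b c d} → a ≤ c → b ≤ d → a + b ≡ c + d → a ≡ c × b ≡ d
+-tight {a} {b} {c} {d} a≤c b≤d eq = a≡c , +-cancelˡ-≡ c b d (trans (cong (_+ b) (sym a≡c)) eq)
  where
  a≡c : a ≡ c
  a≡c = ≤-antisym a≤c (+-cancelʳ-≤ d c a (≤-trans (≤-reflexive (sym eq)) (+-monoʳ-≤ a b≤d)))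

module _ {n : ℕ} (f : Point n → Bool) (D : ℕ) where

  valid≤1 : ∀ b → (if b then 1 else 0) ≤ 1
  valid≤1 b = s≤s⁻¹ (bit<2 b)

  farCount-≤ : ∀ {m} z (ys : Vec (Point n) m) → farCount f D z ys ≤ m
  farCount-≤ z []       = z≤n
  farCount-≤ z (y ∷ ys) = +-mono-≤ (m∸n≤m 1 (D ∸ d_H z y)) (farCount-≤ z ys)

  count-≤ : ∀ {m} (zs : Vec (Point n) m) → count f D zs ≤ maxCount m
  count-≤ []       = z≤n
  count-≤ (z ∷ zs) = +-mono-≤ (valid≤1 (f z)) (+-mono-≤ (farCount-≤ z zs) (count-≤ zs))

  far⇒ : ∀ d → D ≤ d → 1 ∸ (D ∸ d) ≡ 1
  far⇒ d D≤d = cong (1 ∸_) (m≤n⇒m∸n≡0 D≤d)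

  far⇐ : ∀ d → 1 ∸ (D ∸ d) ≡ 1 → D ≤ d
  far⇐ d eq with D ∸ d in e
  ... | zero  = m∸n≡0⇒m≤n e
  ... | suc k = contradiction (trans (sym (0∸n≡0 k)) eq) λ ()

  farCount-full : ∀ {m} z (ys : Vec (Point n) m) → All (λ y → D ≤ d_H z y) ys → farCount f D z ys ≡ m
  farCount-full z []       []       = refl
  farCount-full z (y ∷ ys) (p ∷ ps) = cong₂ _+_ (far⇒ (d_H z y) p) (farCount-full z ys ps)

  full-farCount : ∀ {m} z (ys : Vec (Point n) m) → farCount f D z ys ≡ m → All (λ y → D ≤ d_H z y) ys
  full-farCount z []       eq = []
  full-farCount z (y ∷ ys) eq with +-tight (m∸n≤m 1 (D ∸ d_H z y)) (farCount-≤ z ys) eq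
  ... | e , es = far⇐ (d_H z y) e ∷ full-farCount z ys es

  full⇒count : ∀ {m} (zs : Vec (Point n) m) → Full f D zs → count f D zs ≡ maxCount m
  full⇒count []       _              = refl
  full⇒count (z ∷ zs) (fz , ds , fu) =
    cong₂ _+_ (cong (λ b → if b then 1 else 0) fz) (cong₂ _+_ (farCount-full z zs ds) (full⇒count zs fu))

  count⇒full : ∀ {m} (zs : Vec (Point n) m) → count f D zs ≡ maxCount m → Full f D zs
  count⇒full []       _  = tt
  count⇒full (z ∷ zs) eq with +-tight (valid≤1 (f z)) (+-mono-≤ (farCount-≤ z zs) (count-≤ zs)) eq
  ... | e , es with +-tight (farCount-≤ z zs) (count-≤ zs) es
  ... | e₁ , e₂ = valid (f z) e , full-farCount z zs e₁ , count⇒full zs e₂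
    where
    valid : ∀ b → (if b then 1 else 0) ≡ 1 → b ≡ true
    valid true _ = refl

  -- K dominates all sums of distances,
  -- so a best partner Y′ of X for the weight K * count + α * sumPD is a
  -- scattered one, and among those it is a best one for α * sumPD.
  exchange : ∀ {m} α K (X Y Y′ : Point n) (C : Vec (Point n) m) →
    α ≡ 0 ⊎ α ≡ 1 × D ≤ 1 →
    suc m * suc m * n + n < K →
    (X ≡ Y′ → X ≡ Y) →
    K * count f D (Y ∷ C) + α * sumPD (Y ∷ C) + d_H X Y ≤ K * count f D (Y′ ∷ C) + α * sumPD (Y′ ∷ C) + d_H X Y′ →
    Full f D (X ∷ Y ∷ C) →
    Full f D (X ∷ Y′ ∷ C) × α * sumPD (X ∷ Y ∷ C) ≤ α * sumPD (X ∷ Y′ ∷ C)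
  exchange {m} α K X Y Y′ C mode K-large X≡Y′⇒ better (fX , D≤Y ∷ D≤C , full) =
    (fX , D≤Y′ mode ∷ D≤C , count⇒full (Y′ ∷ C) count≡) , sum≤ mode
    where
    open ≤-Reasoning
    M = maxCount (suc m)
    α≤1 : α ≡ 0 ⊎ α ≡ 1 × D ≤ 1 → α ≤ 1
    α≤1 (inj₁ refl)       = z≤n
    α≤1 (inj₂ (refl , _)) = ≤-refl
    α*≤ : ∀ z → α * z ≤ z
    α*≤ z = ≤-trans (*-monoˡ-≤ z (α≤1 mode)) (≤-reflexive (*-identityˡ z))
    count≡ : count f D (Y′ ∷ C) ≡ M
    count≡ = ≤-antisym (count-≤ (Y′ ∷ C)) (≮⇒≥ λ lt → <-irrefl refl (begin-strict
      K * M                            ≡⟨ cong (K *_) (full⇒count (Y ∷ C) full) ⟨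
      K * count f D (Y ∷ C)            ≤⟨ ≤-trans (m≤m+n _ (α * sumPD (Y ∷ C))) (m≤m+n _ (d_H X Y)) ⟩
      K * count f D (Y ∷ C) + α * sumPD (Y ∷ C) + d_H X Y
                                       ≤⟨ better ⟩
      K * count f D (Y′ ∷ C) + α * sumPD (Y′ ∷ C) + d_H X Y′
                                       ≤⟨ +-mono-≤ (+-monoʳ-≤ _ (≤-trans (α*≤ _) (sumPD-≤ (Y′ ∷ C)))) (d_H-≤ X Y′) ⟩
      K * count f D (Y′ ∷ C) + suc m * suc m * n + n
                                       ≡⟨ +-assoc (K * count f D (Y′ ∷ C)) _ n ⟩
      K * count f D (Y′ ∷ C) + (suc m * suc m * n + n)
                                       <⟨ +-monoʳ-< _ K-large ⟩
      K * count f D (Y′ ∷ C) + K       ≡⟨ +-comm _ K ⟩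
      K + K * count f D (Y′ ∷ C)       ≡⟨ *-suc K _ ⟨
      K * suc (count f D (Y′ ∷ C))     ≤⟨ *-monoʳ-≤ K lt ⟩
      K * M                            ∎))
    better′ : α * sumPD (Y ∷ C) + d_H X Y ≤ α * sumPD (Y′ ∷ C) + d_H X Y′
    better′ = +-cancelˡ-≤ (K * M) _ _ (begin
      K * M + (α * sumPD (Y ∷ C) + d_H X Y)       ≡⟨ +-assoc (K * M) _ _ ⟨
      K * M + α * sumPD (Y ∷ C) + d_H X Y         ≡⟨ cong (λ z → K * z + α * sumPD (Y ∷ C) + d_H X Y) (full⇒count (Y ∷ C) full) ⟨
      K * count f D (Y ∷ C) + α * sumPD (Y ∷ C) + d_H X Y          ≤⟨ better ⟩
      K * count f D (Y′ ∷ C) + α * sumPD (Y′ ∷ C) + d_H X Y′       ≡⟨ cong (λ z → K * z + α * sumPD (Y′ ∷ C) + d_H X Y′) count≡ ⟩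
      K * M + α * sumPD (Y′ ∷ C) + d_H X Y′       ≡⟨ +-assoc (K * M) _ _ ⟩
      K * M + (α * sumPD (Y′ ∷ C) + d_H X Y′)     ∎)
    -- This constraint is not part of the count compared above. For `α = 0`, `better′` says that
    -- `Y′` is at least as far from `X` as `Y`. For `D ≤ 1` only `X ≡ Y′` could violate it, but then
    -- `X ≡ Y`, and `D ≤ d_H X Y` gives `D ≤ 0`.
    D≤Y′ : α ≡ 0 ⊎ α ≡ 1 × D ≤ 1 → D ≤ d_H X Y′
    D≤Y′ (inj₁ refl) = ≤-trans D≤Y better′
    D≤Y′ (inj₂ (_ , D≤1)) with d_H X Y′ in e
    ... | suc _ = ≤-trans D≤1 (s≤s z≤n)
    ... | zero  = subst (D ≤_) (trans (cong (d_H X) (sym (X≡Y′⇒ (d_H≡0⇒≡ X Y′ e)))) (d_H-refl X)) D≤Y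
    sum≡ : ∀ Z → sumPD (X ∷ Z ∷ C) ≡ sumPD (Z ∷ C) + d_H X Z + distances X C
    sum≡ Z = trans (sumPD-∷ X (Z ∷ C)) (regroup (d_H X Z) (distances X C) (sumPD (Z ∷ C)))
      where
      regroup : ∀ a b c → a + b + c ≡ c + a + b
      regroup = solve-∀
    sum≤ : α ≡ 0 ⊎ α ≡ 1 × D ≤ 1 → α * sumPD (X ∷ Y ∷ C) ≤ α * sumPD (X ∷ Y′ ∷ C)
    sum≤ (inj₁ refl) = z≤n
    sum≤ (inj₂ (refl , _)) = +-monoˡ-≤ 0 (begin
      sumPD (X ∷ Y ∷ C)                                ≡⟨ sum≡ Y ⟩
      sumPD (Y ∷ C) + d_H X Y + distances X C          ≤⟨ +-monoˡ-≤ (distances X C) (subst₂ (λ a b → a + d_H X Y ≤ b + d_H X Y′) (+-identityʳ _) (+-identityʳ _) better′) ⟩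
      sumPD (Y′ ∷ C) + d_H X Y′ + distances X C        ≡⟨ sum≡ Y′ ⟨
      sumPD (X ∷ Y′ ∷ C)                               ∎)

-- Registers are ordered such that each subroutine uses an initial segment and
-- leaves the rest abstract. Here rN, rP and rm hold 2ⁿ, (2ⁿ)ᵗ and the best
-- key found so far, rc and rs the count and the sum of distances of a tuple.
pattern ra = zero
pattern rb = suc ra
pattern rj = suc rb
pattern rd = suc rj
pattern rn = suc rd
pattern rN = suc rn
pattern rP = suc rN
pattern rD = suc rP
pattern rz = suc rD
pattern rv = suc rz
pattern rw = suc rv
pattern rc = suc rw
pattern rs = suc rc
pattern rx = suc rs
pattern ry = suc rx
pattern re = suc ry
pattern rm = suc re
pattern ri = suc rm
pattern rp = suc ri
pattern rA = suc rp
pattern rB = suc rA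

infixl 7 _⊹_ _⊖_
infixl 8 _⊛_ _⊘_ _⊜_
infix  6 _≔_

_⊹_ _⊖_ _⊛_ _⊘_ _⊜_ : Expr 21 → Expr 21 → Expr 21
_⊹_ = op add
_⊖_ = op monus
_⊛_ = op mul
_⊘_ = op quot
_⊜_ = op rem

_≔_ : Fin 21 → Expr 21 → Cmd 21
r ≔ e = atom (set r e)

-- Subroutines for distances, counts and sums of distances

distC : Cmd 21
distC =
  rj ≔ reg rn ⨾ rd ≔ lit 0 ⨾
  while (reg rj)
    (rd ≔ reg rd ⊹ (reg ra ⊜ lit 2 ⊹ reg rb ⊜ lit 2) ⊜ lit 2 ⨾
     ra ≔ reg ra ⊘ lit 2 ⨾ rb ≔ reg rb ⊘ lit 2 ⨾ rj ≔ reg rj ⊖ lit 1)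

-- Unrolled, since the number of points is a constant; only the number of digits calls for a loop.
pairsC : ℕ → Cmd 21
pairsC zero    = skip
pairsC (suc m) =
  ra ≔ reg rz ⨾ rb ≔ reg rw ⨾ distC ⨾
  rs ≔ reg rs ⊹ reg rd ⨾ rc ≔ reg rc ⊹ (lit 1 ⊖ (reg rD ⊖ reg rd)) ⨾
  rw ≔ reg rw ⊘ reg rN ⨾ pairsC m

digitsC : ℕ → Cmd 21
digitsC zero    = skip
digitsC (suc m) =
  atom (load ra (reg rv ⊜ reg rN)) ⨾ rc ≔ reg rc ⊹ reg ra ⨾
  rz ≔ reg rv ⨾ rv ≔ reg rv ⊘ reg rN ⨾ rw ≔ reg rv ⨾ pairsC m ⨾ digitsC m

scoreC : ℕ → Cmd 21
scoreC m = rc ≔ lit 0 ⨾ rs ≔ lit 0 ⨾ digitsC m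

-- The summand `n * 5 + 1` is `loopTime n 4`, for the four assignments in the loop body.
distTime : ℕ → ℕ
distTime n = 2 + (n * 5 + 1)

pairsTime : ℕ → ℕ → ℕ
pairsTime n zero    = 1
pairsTime n (suc m) = 2 + (distTime n + (3 + pairsTime n m))

digitsTime : ℕ → ℕ → ℕ
digitsTime n zero    = 1
digitsTime n (suc m) = 5 + (pairsTime n m + digitsTime n m)

scoreTime : ℕ → ℕ → ℕ
scoreTime n m = 2 + digitsTime n m

module Scoring {n : ℕ} (f : Point n → Bool) (X L P : ℕ) where

  open Costed {21} (λ x → f (toPoint n x)) X L

  N : ℕ
  N = 2 ^ n

  data DistState (a b j d : ℕ) (r : Vec ℕ 16) (m : List ℕ) : State 21 → Set where
    st : DistState a b j d r m ⟨ a ∷ b ∷ j ∷ d ∷ n ∷ r , m ⟩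

  dist-run : ∀ {a b j d r m σ} → Bounded σ → DistState a b j d r m σ →
    Run distC σ (distTime n) 0 (λ σ′ → ∃[ a′ ] ∃[ b′ ] ∃[ j′ ] DistState a′ b′ j′ (δ n a b) r m σ′)
  dist-run {a} {b} {r = r} {m} bd st =
    run-set bd n≤X λ bd → run-set bd z≤n λ bd →
    run-post (λ { (a′ , b′ , zero , d′ , refl , i+j , e) → a′ , b′ , 0 , subst (λ z → DistState _ _ _ z _ _ _) (trans (sym (+-identityʳ d′)) e) st
                ; (a′ , b′ , suc j′ , d′ , refl , i+j , e) → contradiction (sym (+-cancelˡ-≡ n (suc j′) 0 (trans i+j (sym (+-identityʳ n))))) λ () })
      (run-while₀ I n body exit bd (a , b , n , 0 , refl , refl , refl))
    where
    n≤X : n ≤ X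
    n≤X = lookup≤ bd rn
    I : ℕ → State 21 → Set
    I i σ = ∃[ a′ ] ∃[ b′ ] ∃[ j′ ] ∃[ d′ ] (σ ≡ ⟨ a′ ∷ b′ ∷ j′ ∷ d′ ∷ n ∷ r , m ⟩ × i + j′ ≡ n × d′ + δ j′ a′ b′ ≡ δ n a b)
    exit : ∀ {σ} → Bounded σ → I n σ → eval σ (reg rj) ≡ 0
    exit _ (a′ , b′ , j′ , d′ , refl , i+j , _) = +-cancelˡ-≡ n j′ 0 (trans i+j (sym (+-identityʳ n)))
    body : ∀ i {σ} → i < n → Bounded σ → I i σ → eval σ (reg rj) ≢ 0 × Run _ σ 4 0 (I (suc i))
    body i i<n bd (a′ , b′ , zero , d′ , refl , i+j , e) = contradiction (trans (sym (+-identityʳ i)) i+j) (<⇒≢ i<n)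
    body i i<n bd (a′ , b′ , suc j′ , d′ , refl , i+j , e) = (λ ()) ,
      (run-set bd d≤ λ bd →
       run-set bd (≤-trans (÷-≤ a′ 2) (lookup≤ bd ra)) λ bd →
       run-set bd (≤-trans (÷-≤ b′ 2) (lookup≤ bd rb)) λ bd →
       run-last bd (≤-trans (n≤1+n j′) (lookup≤ bd rj))
         (_ , _ , _ , _ , refl , trans (sym (+-suc i j′)) i+j , e′))
      where
      e′ : d′ + digit a′ b′ + δ j′ (a′ / 2) (b′ / 2) ≡ δ n a b
      e′ = trans (+-assoc d′ _ _) (trans (cong (d′ +_) (sym (δ-suc j′ a′ b′))) e)
      d≤ : d′ + digit a′ b′ ≤ X
      d≤ = ≤-trans (≤-trans (m≤m+n _ _) (≤-reflexive e′)) (≤-trans (d_H-≤ (toPoint n a) (toPoint n b)) n≤X)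

  data ScoreState (D z v w c s : ℕ) (r : Vec ℕ 8) (m : List ℕ) : State 21 → Set where
    st : ∀ {a b j d} → ScoreState D z v w c s r m ⟨ a ∷ b ∷ j ∷ d ∷ n ∷ N ∷ P ∷ D ∷ z ∷ v ∷ w ∷ c ∷ s ∷ r , m ⟩

  -- The counters only grow, so bounding their final values `c∞` and `s∞` by `X` bounds every
  -- intermediate value. This is why the final values are parameters.
  pairs-run : ∀ k {D z v w c s c∞ s∞ r m σ} → Bounded σ → ScoreState D z v w c s r m σ →
    c + farCount f D (toPoint n z) (decode n k w) ≡ c∞ → s + distances (toPoint n z) (decode n k w) ≡ s∞ →
    c∞ ≤ X → s∞ ≤ X →
    Run (pairsC k) σ (pairsTime n k) 0 (λ σ′ → ∃[ w′ ] ScoreState D z v w′ c∞ s∞ r m σ′)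
  pairs-run zero bd st ec es _ _
    with trans (sym (+-identityʳ _)) ec | trans (sym (+-identityʳ _)) es
  ... | refl | refl = run-skip bd (_ , st)
  pairs-run (suc k) {D} {z} {v} {w} {c} {s} bd st refl refl c≤ s≤ =
    run-set bd (lookup≤ bd rz) λ bd → run-set bd (lookup≤ bd rw) λ bd →
    dist-run bd st ▸ λ { bd (_ , _ , _ , st) →
    run-set bd (≤-trans (+-monoʳ-≤ s (m≤m+n _ _)) s≤) λ bd →
    run-set bd (≤-trans (+-monoʳ-≤ c (m≤m+n _ _)) c≤) λ bd →
    run-set bd (≤-trans (÷-≤ w N) (lookup≤ bd rw)) λ bd →
    pairs-run k bd st (+-assoc c _ _) (+-assoc s _ _) c≤ s≤ }

  Table : List ℕ → Set
  Table m = ∀ x → x < N → read m x ≡ (if f (toPoint n x) then 1 else 0)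

  table-mod : ∀ {m} → Table m → ∀ v → read m (v mod N) ≡ (if f (toPoint n v) then 1 else 0)
  table-mod tab v = trans (tab (v mod N) (mod-< N v (0<2^ n))) (cong (λ z → if f z then 1 else 0) (toPoint-mod n v))

  digits-run : ∀ k {D z v w c s c∞ s∞ r m σ} → Bounded σ → ScoreState D z v w c s r m σ → Table m →
    c + count f D (decode n k v) ≡ c∞ → s + sumPD (decode n k v) ≡ s∞ →
    c∞ ≤ X → s∞ ≤ X →
    Run (digitsC k) σ (digitsTime n k) 0 (λ σ′ → ∃[ z′ ] ∃[ v′ ] ∃[ w′ ] ScoreState D z′ v′ w′ c∞ s∞ r m σ′)
  digits-run zero bd st tab ec es _ _
    with trans (sym (+-identityʳ _)) ec | trans (sym (+-identityʳ _)) es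
  ... | refl | refl = run-skip bd (_ , _ , _ , st)
  digits-run (suc k) {D} {z} {v} {w} {c} {s} {c∞} {s∞} {m = m} bd st tab ec es c≤ s≤ =
    run-load bd λ bd →
    run-set bd (≤-trans (≤-trans (m≤m+n _ _) (≤-trans (m≤m+n _ _) (≤-reflexive ec″))) c≤) λ bd →
    run-set bd (lookup≤ bd rv) λ bd →
    run-set bd (≤-trans (÷-≤ v N) (lookup≤ bd rv)) λ bd →
    run-set bd (lookup≤ bd rv) λ bd →
    pairs-run k bd st refl refl (≤-trans (≤-trans (m≤m+n _ _) (≤-reflexive ec″)) c≤)
                                (≤-trans (≤-trans (m≤m+n _ _) (≤-reflexive es″)) s≤) ▸ λ { bd (_ , st) →
    digits-run k bd st tab ec″ es″ c≤ s≤ }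
    where
    Y = toPoint n v
    Ys = decode n k (v ÷ N)
    regroup : ∀ a b c d → a + b + c + d ≡ a + (b + (c + d))
    regroup = solve-∀
    ec″ : c + read m (v mod N) + farCount f D Y Ys + count f D Ys ≡ c∞
    ec″ = trans (regroup c _ _ _) (trans (cong (λ z → c + (z + (farCount f D Y Ys + count f D Ys))) (table-mod {m} tab v)) ec)
    es″ : s + distances Y Ys + sumPD Ys ≡ s∞
    es″ = trans (+-assoc s _ _) (trans (cong (s +_) (sym (sumPD-∷ Y Ys))) es)

  score-run : ∀ k {D z v w c s r m σ} → Bounded σ → ScoreState D z v w c s r m σ → Table m →
    maxCount k ≤ X → k * k * n ≤ X →
    Run (scoreC k) σ (scoreTime n k) 0 (λ σ′ → ∃[ z′ ] ∃[ v′ ] ∃[ w′ ]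
      ScoreState D z′ v′ w′ (count f D (decode n k v)) (sumPD (decode n k v)) r m σ′)
  score-run k {D} {v = v} bd st tab c≤ s≤ =
    run-set bd z≤n λ bd → run-set bd z≤n λ bd →
    digits-run k bd st tab refl refl (≤-trans (count-≤ f D (decode n k v)) c≤) (≤-trans (sumPD-≤ (decode n k v)) s≤)

-- The search, independently of the machine

n<2^n : ∀ n → n < 2 ^ n
n<2^n zero    = z<s
n<2^n (suc n) = begin-strict
  suc n               <⟨ s<s (n<2^n n) ⟩
  1 + 2 ^ n           ≤⟨ +-monoˡ-≤ (2 ^ n) (0<2^ n) ⟩
  2 ^ n + 2 ^ n       ≡⟨ cong (2 ^ n +_) (+-identityʳ (2 ^ n)) ⟨
  2 ^ suc n           ∎
  where open ≤-Reasoning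

-- The maximum of `a` and `b`, as the program computes it without branching.
bump : ℕ → ℕ → ℕ
bump a b = a + (b ∸ a)

bump-left : ∀ a b → a ≤ bump a b
bump-left a b = m≤m+n a (b ∸ a)

bump-right : ∀ a b → b ≤ bump a b
bump-right a b = m≤n+m∸n b a

bump-sel : ∀ a b → bump a b ≡ a ⊎ bump a b ≡ b
bump-sel a b with ≤-total a b
... | inj₁ a≤b = inj₂ (m+[n∸m]≡n a≤b)
... | inj₂ b≤a = inj₁ (trans (cong (a +_) (m≤n⇒m∸n≡0 b≤a)) (+-identityʳ a))

÷-max : ∀ {c M} → 0 < M → c ≤ M → (c ÷ M ≡ 0) ⊎ (c ÷ M ≡ 1 × c ≡ M)
÷-max {c} {suc M} _ c≤M with m≤n⇒m<n∨m≡n c≤M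
... | inj₁ c<M  = inj₁ (÷-self c<M)
... | inj₂ refl = inj₂ (n/n≡1 (suc M) , refl)

÷-refl : ∀ {M} → 0 < M → M ÷ M ≡ 1
÷-refl {suc M} _ = n/n≡1 (suc M)

-- Here t = s - 2. The number e < E encodes t points and one of the 1 + γ n
-- thresholds. In score, cell and key the factors K, N and Z are so large
-- that the comparison is lexicographic. The quotient by M in key is 1 for a
-- D-scattered tuple of solutions and 0 for any other tuple.
module Search (t α lo γ n : ℕ) (f : Point n → Bool) where

  N s M P E Z κ K : ℕ
  N = 2 ^ n
  s = suc (suc t)
  M = maxCount s
  P = N ^ t
  E = (1 + γ * n) * P
  Z = N * N * E
  κ = suc (suc t * suc t)
  K = κ * N

  threshold : ℕ → ℕ
  threshold e = lo + e ÷ P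

  score : ℕ → ℕ → ℕ
  score D u = K * count f D (decode n (suc t) u) + α * sumPD (decode n (suc t) u)

  -- The summand 1 lifts the key of every scattered tuple to at least `Z`, even when its value would
  -- otherwise be 0; all other tuples with `u < Z` have keys below `Z`.
  value : ℕ → ℕ → ℕ
  value D u = 1 + α * sumPD (decode n s u) + D

  key : ℕ → ℕ → ℕ
  key D u = (count f D (decode n s u) ÷ M) * (value D u * Z) + u

  tuple : ℕ → ℕ → ℕ → ℕ
  tuple x y e = x + N * (y + N * e)

  worth : ℕ → ℕ → ℕ → ℕ
  worth e x y = score (threshold e) (y + N * e) + δ n x y

  cell : ℕ → ℕ → ℕ → ℕ
  cell e x y = y + N * worth e x y

  -- Maximality concerns the packed values, so among equally good partners the one with the largest
  -- code wins, and the low digits of `c` name it.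
  record Layer (e i x c : ℕ) : Set where
    constructor layer
    field
      upper    : ∀ y → y < N → x ÷ 2 ^ i ≡ y ÷ 2 ^ i → cell e x y ≤ c
      attained : ∃[ y ] (y < N × x ÷ 2 ^ i ≡ y ÷ 2 ^ i × c ≡ cell e x y)

  -- Not every `y` is tried as a partner of `x`, but always some `y′` of at least the same worth.
  -- That `y′` may coincide with `x` only if `y` does is the condition under which `exchange`
  -- preserves distinctness.
  Covered : ℕ → ℕ → ℕ → ℕ → Set
  Covered e i x best = ∀ y → y < N → x ÷ 2 ^ i ≡ y ÷ 2 ^ i →
    ∃[ y′ ] (y′ < N × (x ≡ y′ → x ≡ y) × worth e x y ≤ worth e x y′ × key (threshold e) (tuple x y′ e) ≤ best)

  Covered-mono : ∀ {e i x b b′} → b ≤ b′ → Covered e i x b → Covered e i x b′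
  Covered-mono b≤b′ cov y y< eq with cov y y< eq
  ... | y′ , y′< , d , w , k = y′ , y′< , d , w , ≤-trans k b≤b′

  same-block-0 : ∀ x y → x ÷ 1 ≡ y ÷ 1 → x ≡ y
  same-block-0 x y eq = trans (sym (n/1≡n x)) (trans eq (n/1≡n y))

  layer-zero : ∀ e x → x < N → Layer e 0 x (x + N * score (threshold e) (x + N * e))
  layer-zero e x x< = layer (λ y _ eq → ≤-reflexive (sym (at y (same-block-0 x y eq)))) (x , x< , refl , at x refl)
    where
    at : ∀ y → x ≡ y → x + N * score (threshold e) (x + N * e) ≡ cell e x y
    at y refl = cong (λ z → x + N * z) (sym (trans (cong (score (threshold e) (x + N * e) +_) (d_H-refl (toPoint n x))) (+-identityʳ _)))

  covered-zero : ∀ e x best → key (threshold e) (tuple x x e) ≤ best → x < N → Covered e 0 x best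
  covered-zero e x best k x< y y< eq with same-block-0 x y eq
  ... | refl = x , x< , (λ _ → refl) , ≤-refl , k

  module _ {e i x : ℕ} (i<n : i < n) where

    x′ : ℕ
    x′ = neighbour (2 ^ i) x

    worth-neighbour : ∀ y → x′ ÷ 2 ^ i ≡ y ÷ 2 ^ i → worth e x y ≡ suc (worth e x′ y)
    worth-neighbour y eq = trans (cong (score (threshold e) (y + N * e) +_) (δ-neighbour i x y i<n eq)) (+-suc _ _)

    -- In a packed cell `N` is one unit of worth: adding it accounts for the flipped digit and
    -- leaves the witness alone.
    cell-neighbour : ∀ y → x′ ÷ 2 ^ i ≡ y ÷ 2 ^ i → cell e x′ y + N ≡ cell e x y
    cell-neighbour y eq = trans (regroup y N (worth e x′ y)) (cong (λ z → y + N * z) (sym (worth-neighbour y eq)))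
      where
      regroup : ∀ a b c → a + b * c + b ≡ a + b * suc c
      regroup = solve-∀

    up-block : ∀ y → x′ ÷ 2 ^ i ≡ y ÷ 2 ^ i → x ÷ 2 ^ suc i ≡ y ÷ 2 ^ suc i
    up-block y eq = trans (sym (neighbour-block i x)) (block-mono i x′ y eq)

    layer-suc : ∀ {A B} → Layer e i x A → Layer e i x′ B → Layer e (suc i) x (bump A (B + N))
    layer-suc {A} {B} (layer upA (yA , yA< , eqA , A≡)) (layer upB (yB , yB< , eqB , B≡)) = layer upper attained
      where
      upper : ∀ y → y < N → x ÷ 2 ^ suc i ≡ y ÷ 2 ^ suc i → cell e x y ≤ bump A (B + N)
      upper y y< eq with block-split i x y eq
      ... | inj₁ eq′ = ≤-trans (upA y y< eq′) (bump-left A (B + N))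
      ... | inj₂ eq′ = ≤-trans (≤-reflexive (sym (cell-neighbour y eq′)))
                         (≤-trans (+-monoˡ-≤ N (upB y y< eq′)) (bump-right A (B + N)))
      attained : ∃[ y ] (y < N × x ÷ 2 ^ suc i ≡ y ÷ 2 ^ suc i × bump A (B + N) ≡ cell e x y)
      attained with bump-sel A (B + N)
      ... | inj₁ eq = yA , yA< , block-mono i x yA eqA , trans eq A≡
      ... | inj₂ eq = yB , yB< , up-block yB eqB , trans eq (trans (cong (_+ N) B≡) (cell-neighbour yB eqB))

    -- A `y` in the old block of `x` was covered before. For a `y` in the neighbouring block, the
    -- witness of `B` lies in that block too, hence differs from `x`, and `packed-≤` compares the
    -- worths.
    covered-suc : ∀ {B best} → Layer e i x′ B → key (threshold e) (tuple x ((B + N) mod N) e) ≤ best →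
      Covered e i x best → Covered e (suc i) x best
    covered-suc {B} {best} (layer upB (yB , yB< , eqB , B≡)) k cov y y< eq with block-split i x y eq
    ... | inj₁ eq′ = cov y y< eq′
    ... | inj₂ eq′ = yB , yB< , (λ x≡yB → contradiction x≡yB (neighbour-≢ i x yB eqB)) ,
      ≤-trans (≤-reflexive (worth-neighbour y eq′))
        (≤-trans (s≤s (packed-≤ N {k = y} yB< (≤-trans (upB y y< eq′) (≤-reflexive B≡)))) (≤-reflexive (sym (worth-neighbour yB eqB)))) ,
      subst (λ z → key (threshold e) (tuple x z e) ≤ best) B-mod k
      where
      B-mod : (B + N) mod N ≡ yB
      B-mod = trans (cong (_mod N) (trans (cong (_+ N) B≡) (cell-neighbour yB eqB))) (mod-+ N (worth e x yB) yB<)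

  InRange : ℕ → Set
  InRange D = lo ≤ D × D ≤ lo + γ * n

  -- The register holds its initial 0 or the key of an actual tuple, however that tuple was found;
  -- this is the half of correctness that does not rest on the table.
  Sound : ℕ → Set
  Sound b = b ≡ 0 ⊎ ∃[ D ] ∃[ u ] (InRange D × u < Z × b ≡ key D u)

  sound-bump : ∀ {b D u} → Sound b → InRange D → u < Z → Sound (bump b (key D u))
  sound-bump {b} {D} {u} so r u< with bump-sel b (key D u)
  ... | inj₁ eq = subst Sound (sym eq) so
  ... | inj₂ eq = inj₂ (D , u , r , u< , eq)

  0<N : 0 < N
  0<N = 0<2^ n

  0<P : 0 < P
  0<P = m^n>0 (2 ^ n) {{>-nonZero 0<N}} t

  tuple-< : ∀ {x y e} → x < N → y < N → e < E → tuple x y e < Z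
  tuple-< {x} {y} {e} x< y< e< = subst (tuple x y e <_) (sym (*-assoc N N E))
    (+-*-< N (N * E) x< (+-*-< N E y< e<))

  threshold-range : ∀ {e} → e < E → InRange (threshold e)
  threshold-range {e} e< = m≤m+n lo _ , +-monoʳ-≤ lo (s≤s⁻¹ (÷-< P (1 + γ * n) e e<))

  -- `X` adds up bounds for all numbers ever stored, which is generous but still of polynomial bit
  -- length. `L` provides `n + 2` rows, for `f` and layers 0 to `n`, and `s` more cells because for
  -- small `n` the output may be longer than the rows.
  keyCap cellCap X L : ℕ
  keyCap  = (2 + α * (s * s * n) + (lo + γ * n)) * Z
  cellCap = N * suc (K * maxCount (suc t) + α * (suc t * suc t * n) + n)
  X = keyCap + cellCap + (M + s * s * n + suc n)
  L = suc (suc n) * N + s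

  keyCap≤X : keyCap ≤ X
  keyCap≤X = ≤-trans (m≤m+n keyCap cellCap) (m≤m+n _ _)

  cellCap≤X : cellCap ≤ X
  cellCap≤X = ≤-trans (m≤n+m cellCap keyCap) (m≤m+n _ _)

  M≤X : M ≤ X
  M≤X = ≤-trans (≤-trans (m≤m+n M _) (m≤m+n (M + s * s * n) (suc n))) (m≤n+m _ (keyCap + cellCap))

  s*s*n≤X : s * s * n ≤ X
  s*s*n≤X = ≤-trans (≤-trans (m≤n+m _ M) (m≤m+n (M + s * s * n) (suc n))) (m≤n+m _ (keyCap + cellCap))

  1+n≤X : suc n ≤ X
  1+n≤X = ≤-trans (m≤n+m (suc n) (M + s * s * n)) (m≤n+m _ (keyCap + cellCap))

  N≤X : N ≤ X
  N≤X = ≤-trans (m≤m*n N _) cellCap≤X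

  Z≤X : Z ≤ X
  Z≤X = ≤-trans (m≤n*m Z (2 + α * (s * s * n) + (lo + γ * n))) keyCap≤X

  E≤Z : E ≤ Z
  E≤Z = m≤n*m E (N * N) {{m*n≢0 N N {{>-nonZero 0<N}} {{>-nonZero 0<N}}}}

  E≤X : E ≤ X
  E≤X = ≤-trans E≤Z Z≤X

  P≤X : P ≤ X
  P≤X = ≤-trans (m≤m+n P _) E≤X

  0<Z : 0 < Z
  0<Z = ≤-trans (≤-trans 0<P (m≤m+n P _)) E≤Z

  key≤X : ∀ {D u} → D ≤ lo + γ * n → u < Z → key D u ≤ X
  key≤X {D} {u} D≤ u< = begin
    (count f D (decode n s u) ÷ M) * (value D u * Z) + u  ≤⟨ +-mono-≤ (*-monoˡ-≤ (value D u * Z) q≤1) (<⇒≤ u<) ⟩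
    1 * (value D u * Z) + Z      ≡⟨ regroup (value D u) Z ⟩
    suc (value D u) * Z          ≤⟨ *-monoˡ-≤ Z (s≤s (+-mono-≤ (s≤s (*-monoʳ-≤ α (sumPD-≤ (decode n s u)))) D≤)) ⟩
    keyCap                       ≤⟨ keyCap≤X ⟩
    X                            ∎
    where
    open ≤-Reasoning
    regroup : ∀ a z → 1 * (a * z) + z ≡ suc a * z
    regroup = solve-∀
    q≤1 : count f D (decode n s u) ÷ M ≤ 1
    q≤1 with ÷-max {M = M} z<s (count-≤ f D (decode n s u))
    ... | inj₁ eq       = ≤-trans (≤-reflexive eq) z≤n
    ... | inj₂ (eq , _) = ≤-reflexive eq

  D≤X : ∀ {D} → D ≤ lo + γ * n → D ≤ X
  D≤X {D} D≤ = ≤-trans (≤-trans (≤-trans D≤ (m≤n+m _ (2 + α * (s * s * n)))) (m≤m*n _ Z {{>-nonZero 0<Z}})) keyCap≤X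

  cell≤X : ∀ e x y → y < N → cell e x y ≤ X
  cell≤X e x y y< = ≤-trans (begin
    y + N * worth e x y        ≤⟨ +-mono-≤ (<⇒≤ y<) (*-monoʳ-≤ N (+-mono-≤ (+-mono-≤ (*-monoʳ-≤ K (count-≤ f _ (decode n (suc t) _))) (*-monoʳ-≤ α (sumPD-≤ (decode n (suc t) _)))) (d_H-≤ (toPoint n x) (toPoint n y)))) ⟩
    N + N * (K * maxCount (suc t) + α * (suc t * suc t * n) + n)  ≡⟨ *-suc N _ ⟨
    cellCap                    ∎) cellCap≤X
    where open ≤-Reasoning

  AllCovered : ℕ → ℕ → Set
  AllCovered e b = ∀ e′ → e′ < e → ∀ x → x < N → Covered e′ n x b

  Optimal : ∀ D → Vec (Point n) s → Set
  Optimal D zs = Full f D zs × (∀ D′ (zs′ : Vec (Point n) s) → InRange D′ → Full f D′ zs′ → α * sumPD zs′ + D′ ≤ α * sumPD zs + D)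

  -- The first term bounds the sum of distances of `suc t` points and the second the distance to one
  -- more; together they are `κ * n`, and `n < 2 ^ n`.
  K-large : suc t * suc t * n + n < K
  K-large = begin-strict
    suc t * suc t * n + n        ≡⟨ +-comm (suc t * suc t * n) n ⟩
    κ * n                        <⟨ *-monoʳ-< κ (n<2^n n) ⟩
    K                            ∎
    where open ≤-Reasoning

  module _ (mode : α ≡ 0 ⊎ α ≡ 1 × lo ≤ 1 × γ ≡ 0) where

    mode-at : ∀ {D} → InRange D → α ≡ 0 ⊎ α ≡ 1 × D ≤ 1
    mode-at {D} r = Sum.map₂ (λ { (α≡1 , lo≤1 , γ≡0) → α≡1 , ≤-trans (proj₂ r) (subst (λ z → lo + z * n ≤ 1) (sym γ≡0) (≤-trans (≤-reflexive (+-identityʳ lo)) lo≤1)) }) mode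

    -- The iteration `e` belonging to `C` and `D` has covered the pair `X`, `Y`, since blocks of
    -- length `2 ^ n` contain all codes. It tried some `Y′` in place of `Y`, and by `exchange` the
    -- resulting tuple is scattered and no worse, so its key bounds the left side.
    dominated : ∀ {b} → AllCovered E b → ∀ D (zs : Vec (Point n) s) → InRange D → Full f D zs →
      (1 + α * sumPD zs + D) * Z ≤ b
    dominated {b} cov D (X ∷ Y ∷ C) (lo≤D , D≤) full with cov e e< x (fromPoint-< X) y (fromPoint-< Y) (trans (÷-self (fromPoint-< X)) (sym (÷-self (fromPoint-< Y))))
      where
      x = fromPoint X
      y = fromPoint Y
      e = encode C + P * (D ∸ lo)
      e< : e < E
      e< = subst (e <_) (*-comm P (1 + γ * n)) (+-*-< P (1 + γ * n) (encode-< C) (s≤s (≤-trans (∸-monoˡ-≤ lo D≤) (≤-reflexive (m+n∸m≡n lo (γ * n))))))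
    ... | y′ , y′< , distinct , better , k = begin
      (1 + α * sumPD (X ∷ Y ∷ C) + D) * Z           ≤⟨ *-monoˡ-≤ Z (+-monoˡ-≤ D (s≤s (proj₂ swapped))) ⟩
      (1 + α * sumPD (X ∷ Y′ ∷ C) + D) * Z          ≡⟨ cong (λ zs → (1 + α * sumPD zs + D) * Z) u-decodes ⟨
      value D u * Z                                 ≤⟨ ≤-reflexive (sym (trans (cong (_* (value D u * Z)) q≡1) (*-identityˡ _))) ⟩
      (count f D (decode n s u) ÷ M) * (value D u * Z) ≤⟨ m≤m+n _ u ⟩
      key D u                                       ≡⟨ cong (λ d → key d u) threshold≡ ⟨
      key (threshold e) u                           ≤⟨ k ⟩
      b                                             ∎
      where
      open ≤-Reasoning
      x = fromPoint X
      y = fromPoint Y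
      e = encode C + P * (D ∸ lo)
      u = tuple x y′ e
      Y′ = toPoint n y′
      threshold≡ : threshold e ≡ D
      threshold≡ = trans (cong (lo +_) (div-+ P (D ∸ lo) (encode-< C))) (m+[n∸m]≡n lo≤D)
      C-decodes : decode n t e ≡ C
      C-decodes = trans (decode-+* n t (encode C) (D ∸ lo)) (decode-encode C)
      partner : ∀ {z} → z < N → decode n (suc t) (z + N * e) ≡ toPoint n z ∷ C
      partner {z} z< = trans (decode-+ n t z e z<) (cong (toPoint n z ∷_) C-decodes)
      u-decodes : decode n s u ≡ X ∷ Y′ ∷ C
      u-decodes = trans (decode-+ n (suc t) x (y′ + N * e) (fromPoint-< X)) (cong₂ _∷_ (toPoint-fromPoint X) (partner y′<))
      worth≡ : ∀ {z} → z < N → worth e x z ≡ K * count f D (toPoint n z ∷ C) + α * sumPD (toPoint n z ∷ C) + d_H X (toPoint n z)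
      worth≡ {z} z< = trans
        (cong₂ (λ d zs → K * count f d zs + α * sumPD zs + δ n x z) threshold≡ (partner z<))
        (cong (λ p → K * count f D (toPoint n z ∷ C) + α * sumPD (toPoint n z ∷ C) + d_H p (toPoint n z)) (toPoint-fromPoint X))
      better′ : K * count f D (Y ∷ C) + α * sumPD (Y ∷ C) + d_H X Y ≤ K * count f D (Y′ ∷ C) + α * sumPD (Y′ ∷ C) + d_H X Y′
      better′ = subst₂ _≤_
        (trans (worth≡ (fromPoint-< Y)) (cong (λ p → K * count f D (p ∷ C) + α * sumPD (p ∷ C) + d_H X p) (toPoint-fromPoint Y)))
        (worth≡ y′<) better
      distinct′ : X ≡ Y′ → X ≡ Y
      distinct′ eq = trans (sym (toPoint-fromPoint X)) (trans (cong (toPoint n) (distinct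
        (toPoint-injective n (fromPoint-< X) y′< (trans (toPoint-fromPoint X) eq)))) (toPoint-fromPoint Y))
      swapped : Full f D (X ∷ Y′ ∷ C) × α * sumPD (X ∷ Y ∷ C) ≤ α * sumPD (X ∷ Y′ ∷ C)
      swapped = exchange f D α K X Y Y′ C (mode-at (lo≤D , D≤)) K-large distinct′ better′ full
      q≡1 : count f D (decode n s u) ÷ M ≡ 1
      q≡1 = trans (cong (λ zs → count f D zs ÷ M) u-decodes)
        (trans (cong (_÷ M) (full⇒count f D (X ∷ Y′ ∷ C) (proj₁ swapped))) (÷-refl {M} z<s))

    -- With quotient 0 the key would be `u` and lie below `Z`. So the quotient is 1, all constraints
    -- hold, and `packed-≤` with low part `u` compares the values.
    key-quotient : ∀ D u b D′ (zs : Vec (Point n) s) → u < Z → b ≡ key D u → (1 + α * sumPD zs + D′) * Z ≤ b →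
      Full f D (decode n s u) × α * sumPD zs + D′ ≤ α * sumPD (decode n s u) + D
    key-quotient D u b D′ zs u< refl dom with ÷-max {M = M} z<s (count-≤ f D (decode n s u))
    ... | inj₁ q≡0 = contradiction (≤-trans (m≤n*m Z (1 + α * sumPD zs + D′)) (≤-trans dom (≤-reflexive (cong (λ q → q * (value D u * Z) + u) q≡0)))) (<⇒≱ u<)
    ... | inj₂ (q≡1 , full) = count⇒full f D (decode n s u) full , s≤s⁻¹ (packed-≤ Z {k = 0} u< (≤-trans
      (≤-reflexive (*-comm Z (1 + α * sumPD zs + D′))) (≤-trans dom (≤-reflexive (trans
        (cong (λ q → q * (value D u * Z) + u) q≡1) (regroup (value D u) Z u))))))
      where
      regroup : ∀ a z u → 1 * (a * z) + u ≡ u + z * a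
      regroup = solve-∀

    -- One scattered tuple shows that the register has left its initial value 0; then each
    -- competitor is compared with the tuple in the low digits of `b`.
    optimal : ∀ {b} → Sound b → AllCovered E b →
      ∀ D (zs : Vec (Point n) s) → InRange D → Full f D zs →
      ∃[ D′ ] (InRange D′ × Optimal D′ (decode n s (b mod Z)))
    optimal {b} (inj₁ refl) cov D zs r full =
      contradiction (≤-trans (m≤n*m Z (1 + α * sumPD zs + D)) (dominated cov D zs r full)) (<⇒≱ 0<Z)
    optimal {b} (inj₂ (D′ , u , r′ , u< , b≡)) cov D zs r full = D′ , r′ ,
      subst (λ v → Optimal D′ (decode n s v)) (sym b-mod)
        (proj₁ (key-quotient D′ u b D zs u< b≡ (dominated cov D zs r full)) ,
         λ D″ zs″ r″ full″ → proj₂ (key-quotient D′ u b D″ zs″ u< b≡ (dominated cov D″ zs″ r″ full″)))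
      where
      q = count f D′ (decode n s u) ÷ M
      regroup : ∀ q a z u → q * (a * z) + u ≡ u + z * (q * a)
      regroup = solve-∀
      b-mod : b mod Z ≡ u
      b-mod = trans (cong (_mod Z) (trans b≡ (regroup q (value D′ u) Z u))) (mod-+ Z (q * value D′ u) u<)

-- The program

powerC : ℕ → Cmd 21
powerC zero    = rP ≔ lit 1
powerC (suc t) = powerC t ⨾ rP ≔ reg rN ⊛ reg rP

outC : ℕ → ℕ → Cmd 21
outC a zero    = skip
outC a (suc k) = atom (store (lit a) (reg rm)) ⨾ rm ≔ reg rm ⊘ reg rN ⨾ outC (suc a) k

-- The memory consists of rows of N = 2ⁿ cells: f in row 0 and layer i of the
-- table in row i + 1. The input in cell 0 is overwritten.
module Program (t α lo γ : ℕ) where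

  s κ : ℕ
  s = suc (suc t)
  κ = suc (suc t * suc t)

  E Z : Expr 21
  E = (lit 1 ⊹ lit γ ⊛ reg rn) ⊛ reg rP
  Z = reg rN ⊛ reg rN ⊛ E

  tupleE : Expr 21
  tupleE = reg rx ⊹ reg rN ⊛ (reg ry ⊹ reg rN ⊛ reg re)

  keyE : Expr 21
  keyE = (reg rc ⊘ lit (maxCount s)) ⊛ ((lit 1 ⊹ lit α ⊛ reg rs ⊹ reg rD) ⊛ Z) ⊹ tupleE

  candidateC : Cmd 21
  candidateC = rv ≔ tupleE ⨾ scoreC s ⨾ rm ≔ reg rm ⊹ (keyE ⊖ reg rm)

  startC : Cmd 21
  startC =
    rv ≔ reg rx ⊹ reg rN ⊛ reg re ⨾ scoreC (suc t) ⨾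
    atom (store (lit 1 ⊛ reg rN ⊹ reg rx) (reg rx ⊹ reg rN ⊛ (lit κ ⊛ reg rN ⊛ reg rc ⊹ lit α ⊛ reg rs))) ⨾
    -- A block of length 1 offers only `y = x`, a legitimate candidate when `D` is 0.
    ry ≔ reg rx ⨾ candidateC ⨾ rx ≔ lit 1 ⊹ reg rx

  cellC : Cmd 21
  cellC =
    atom (load rA ((lit 1 ⊹ reg ri) ⊛ reg rN ⊹ reg rx)) ⨾
    atom (load rB ((lit 1 ⊹ reg ri) ⊛ reg rN ⊹
      (reg rx ⊜ reg rp ⊹ reg rp ⊛ (reg rx ⊘ reg rp ⊹ lit 1 ⊖ lit 2 ⊛ ((reg rx ⊘ reg rp) ⊜ lit 2))))) ⨾
    rB ≔ reg rB ⊹ reg rN ⨾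
    atom (store ((lit 2 ⊹ reg ri) ⊛ reg rN ⊹ reg rx) (reg rA ⊹ (reg rB ⊖ reg rA))) ⨾
    -- The partner comes from the neighbour's cell and not from the maximum just stored, so one
    -- distinct from `x` is tried even if the block of `x` wins.
    ry ≔ reg rB ⊜ reg rN ⨾ candidateC ⨾ rx ≔ lit 1 ⊹ reg rx

  layerC : Cmd 21
  layerC = rx ≔ lit 0 ⨾ while (reg rN ⊖ reg rx) cellC ⨾ rp ≔ lit 2 ⊛ reg rp ⨾ ri ≔ lit 1 ⊹ reg ri

  epochC : Cmd 21
  epochC =
    rD ≔ lit lo ⊹ reg re ⊘ reg rP ⨾ rx ≔ lit 0 ⨾ while (reg rN ⊖ reg rx) startC ⨾
    ri ≔ lit 0 ⨾ rp ≔ lit 1 ⨾ while (reg rn ⊖ reg ri) layerC ⨾ re ≔ lit 1 ⊹ reg re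

  doubleC tableC mainC : Cmd 21
  doubleC = rN ≔ lit 2 ⊛ reg rN ⨾ ri ≔ lit 1 ⊹ reg ri
  tableC  = atom (query ry (reg rx)) ⨾ atom (store (reg rx) (reg ry)) ⨾ rx ≔ lit 1 ⊹ reg rx
  mainC   =
    atom (load rn (lit 0)) ⨾ rN ≔ lit 1 ⨾ while (reg rn ⊖ reg ri) doubleC ⨾ powerC t ⨾
    -- The remainder by `Z` strips the value from the best key and leaves the code of its tuple.
    while (reg rN ⊖ reg rx) tableC ⨾ while (E ⊖ reg re) epochC ⨾ rm ≔ reg rm ⊜ Z ⨾ outC 0 s

  algorithm : Algorithm
  algorithm = record { #regs = 21 ; code = mainC }

  candidateTime startTime cellTime layerTime epochTime mainTime : ℕ → ℕ
  candidateTime n = 1 + (scoreTime n s + 1)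
  startTime n = 1 + (scoreTime n (suc t) + (2 + (candidateTime n + 1)))
  cellTime n = 5 + (candidateTime n + 1)
  layerTime n = 1 + ((2 ^ n * suc (cellTime n) + 1) + 2)
  epochTime n = 2 + ((2 ^ n * suc (startTime n) + 1) + (2 + ((n * suc (layerTime n) + 1) + 1)))
  mainTime n = 2 + ((n * 3 + 1) + (suc t + ((2 ^ n * 4 + 1) +
    (((1 + γ * n) * (2 ^ n) ^ t * suc (epochTime n) + 1) + (1 + suc (2 * s))))))

-- Invariants and step counts of the program

module Correct (t α lo γ n : ℕ) (f : Point n → Bool) where

  open Search t α lo γ n f
  open Program t α lo γ hiding (s; κ; E; Z)
  open Scoring f X L P hiding (N)
  open Costed {21} (λ x → f (toPoint n x)) X L

  data SearchState (D x y e b i p A B : ℕ) (m : List ℕ) : State 21 → Set where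
    st : ∀ {a b′ j d z v w c s} → SearchState D x y e b i p A B m
      ⟨ a ∷ b′ ∷ j ∷ d ∷ n ∷ N ∷ P ∷ D ∷ z ∷ v ∷ w ∷ c ∷ s ∷ x ∷ y ∷ e ∷ b ∷ i ∷ p ∷ A ∷ B ∷ [] , m ⟩

  bump≤ : ∀ {a b} → a ≤ X → b ≤ X → bump a b ≤ X
  bump≤ {a} {b} a≤ b≤ with bump-sel a b
  ... | inj₁ eq = ≤-trans (≤-reflexive eq) a≤
  ... | inj₂ eq = ≤-trans (≤-reflexive eq) b≤

  candidate-run : ∀ {D x y e b i p A B m σ} → Bounded σ → SearchState D x y e b i p A B m σ → Table m →
    D ≤ lo + γ * n → tuple x y e < Z →
    Run candidateC σ (candidateTime n) 0 (SearchState D x y e (bump b (key D (tuple x y e))) i p A B m)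
  candidate-run bd st tab D≤ u< =
    run-set bd (≤-trans (<⇒≤ u<) Z≤X) λ bd →
    score-run s bd st tab M≤X s*s*n≤X ▸ λ { bd (_ , _ , _ , st) →
    run-last bd (bump≤ (lookup≤ bd rm) (key≤X D≤ u<)) st }

  row-injective : ∀ {r r′ x x′} → x < N → x′ < N → r * N + x ≡ r′ * N + x′ → r ≡ r′ × x ≡ x′
  row-injective {r} {r′} {x} {x′} x< x′< eq =
    trans (sym (div-+ N r x<)) (trans (cong (_÷ N) eq′) (div-+ N r′ x′<)) ,
    trans (sym (mod-+ N r x<)) (trans (cong (_mod N) eq′) (mod-+ N r′ x′<))
    where
    swap : ∀ r x N → x + N * r ≡ r * N + x
    swap = solve-∀
    eq′ : x + N * r ≡ x′ + N * r′
    eq′ = trans (swap r x N) (trans eq (sym (swap r′ x′ N)))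

  other-row : ∀ m {r r′ x x′} v → x < N → x′ < N → r′ ≢ r →
    read (write m (r * N + x) v) (r′ * N + x′) ≡ read m (r′ * N + x′)
  other-row m v x< x′< r≢ = read-write-≢ m _ v λ eq → r≢ (proj₁ (row-injective x′< x< eq))

  other-cell : ∀ m {r x x′} v → x < N → x′ < N → x′ ≢ x →
    read (write m (r * N + x) v) (r * N + x′) ≡ read m (r * N + x′)
  other-cell m {r} v x< x′< x≢ = read-write-≢ m _ v λ eq → x≢ (proj₂ (row-injective {r} {r} x′< x< eq))

  Row : (ℕ → ℕ → Set) → ℕ → ℕ → List ℕ → Set
  Row Q r x m = ∀ x′ → x′ < x → Q x′ (read m (r * N + x′))

  row-write : ∀ {Q r x v} m → x < N → Row Q r x m → Q x v → Row Q r (suc x) (write m (r * N + x) v)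
  row-write {Q} {r} {x} {v} m x< row q x′ x′< with m<1+n⇒m<n∨m≡n x′<
  ... | inj₁ lt   = subst (Q x′) (sym (other-cell m {r} v x< (<-trans lt x<) (<⇒≢ lt))) (row x′ lt)
  ... | inj₂ refl = subst (Q x) (sym (read-write-≡ m (r * N + x) v)) q

  row-keep : ∀ {Q r r′ x v} m → x < N → r′ ≢ r → Row Q r′ N m → Row Q r′ N (write m (r * N + x) v)
  row-keep {Q} {v = v} m x< r≢ row x′ x′< = subst (Q x′) (sym (other-row m v x< x′< r≢)) (row x′ x′<)

  table-keep : ∀ {r x v} m → x < N → 0 ≢ r → Table m → Table (write m (r * N + x) v)
  table-keep {r} m x< r≢ tab = row-keep {λ x c → c ≡ (if f (toPoint n x) then 1 else 0)} {r} {0} m x< r≢ tab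

  address-< : ∀ {r x} → r < suc (suc n) → x < N → r * N + x < L
  address-< {r} {x} r< x< = begin-strict
    r * N + x            <⟨ +-monoʳ-< (r * N) x< ⟩
    r * N + N            ≡⟨ +-comm (r * N) N ⟩
    suc r * N            ≤⟨ *-monoˡ-≤ N r< ⟩
    suc (suc n) * N      ≤⟨ m≤m+n _ s ⟩
    L                    ∎
    where open ≤-Reasoning

  extend : ∀ {Q : ℕ → Set} {x} → (∀ x′ → x′ < x → Q x′) → Q x → ∀ x′ → x′ < suc x → Q x′
  extend qs q x′ x′< with m<1+n⇒m<n∨m≡n x′<
  ... | inj₁ lt   = qs x′ lt
  ... | inj₂ refl = q

  -- `b₀` is the best key at the start of the epoch; `b₀ ≤ b` preserves the coverage reached in
  -- earlier epochs without restating it in the inner loops.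
  data StartInv (e b₀ x : ℕ) (σ : State 21) : Set where
    inv : ∀ {y b i p A B m} → SearchState (threshold e) x y e b i p A B m σ → Table m →
      Row (Layer e 0) 1 x m → (∀ x′ → x′ < x → Covered e 0 x′ b) → b₀ ≤ b → Sound b → StartInv e b₀ x σ

  start-run : ∀ {e b₀} x {σ} → e < E → x < N → Bounded σ → StartInv e b₀ x σ →
    eval σ (reg rN ⊖ reg rx) ≢ 0 × Run startC σ (startTime n) 0 (StartInv e b₀ (suc x))
  start-run {e} x e< x< bd (inv {b = b} {m = m} st tab row cov b₀≤ so) = m>n⇒m∸n≢0 x< ,
    (run-set bd (≤-trans (<⇒≤ ye<) E*N≤X) λ bd →
     score-run (suc t) bd st tab (≤-trans maxCount≤ M≤X) (≤-trans (*-monoˡ-≤ n (*-mono-≤ (n≤1+n (suc t)) (n≤1+n (suc t)))) s*s*n≤X) ▸ λ { bd (_ , _ , _ , st) →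
     run-store bd (address-< {1} (s≤s (s≤s z≤n)) x<) cell≤ λ bd →
     run-set bd (lookup≤ bd rx) λ bd →
     candidate-run bd st (table-keep {1} m x< (λ ()) tab) (proj₂ (threshold-range e<)) (tuple-< x< x< e<) ▸ λ { bd st →
     run-last bd (≤-trans x< N≤X) (inv st (table-keep {1} m x< (λ ()) tab) (row-write {Layer e 0} {1} m x< row (layer-zero e x x<))
       (extend (λ x′ lt → Covered-mono {e} {0} (bump-left b _) (cov x′ lt)) (covered-zero e x _ (bump-right b _) x<))
       (≤-trans b₀≤ (bump-left _ _)) (sound-bump so (threshold-range e<) (tuple-< x< x< e<))) } })
    where
    ye< : x + N * e < N * E
    ye< = +-*-< N E x< e<
    E*N≤X : N * E ≤ X
    E*N≤X = ≤-trans (m≤n*m (N * E) N {{>-nonZero 0<N}}) (≤-trans (≤-reflexive (sym (*-assoc N N E))) Z≤X)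
    maxCount≤ : maxCount (suc t) ≤ M
    maxCount≤ = ≤-trans (m≤n+m (maxCount (suc t)) (suc t)) (n≤1+n _)
    cell≤ : x + N * score (threshold e) (x + N * e) ≤ X
    cell≤ = ≤-trans (+-monoʳ-≤ x (*-monoʳ-≤ N (m≤m+n _ _))) (cell≤X e x x x<)

  -- Layers `i` and `suc i` live in different rows: the cell of a neighbour is read at layer `i`
  -- even after that neighbour itself has been processed.
  data CellInv (e b₀ i x : ℕ) (σ : State 21) : Set where
    inv : ∀ {y b A B m} → SearchState (threshold e) x y e b i (2 ^ i) A B m σ → Table m →
      Row (Layer e i) (suc i) N m → Row (Layer e (suc i)) (suc (suc i)) x m →
      (∀ x′ → x′ < N → Covered e i x′ b) → (∀ x′ → x′ < x → Covered e (suc i) x′ b) →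
      b₀ ≤ b → Sound b → CellInv e b₀ i x σ

  cell-run : ∀ {e b₀ i} x {σ} → e < E → i < n → x < N → Bounded σ → CellInv e b₀ i x σ →
    eval σ (reg rN ⊖ reg rx) ≢ 0 × Run cellC σ (cellTime n) 0 (CellInv e b₀ i (suc x))
  cell-run {e} {b₀} {i} x e< i<n x< bd (inv {b = b} {m = m} st tab row row′ cov cov′ b₀≤ so) = m>n⇒m∸n≢0 x< ,
    (run-load bd λ bd → run-load bd λ bd →
     run-set bd B+N≤ λ bd →
     run-store bd (address-< {suc (suc i)} (s≤s (s≤s i<n)) x<) (bump≤ (lookup≤ bd rA) (lookup≤ bd rB)) λ bd →
     run-set bd (≤-trans (<⇒≤ y<) N≤X) λ bd →
     candidate-run bd st tab″ (proj₂ (threshold-range e<)) u< ▸ λ { bd st →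
     run-last bd (≤-trans x< N≤X) (inv st tab″
       (row-keep {Layer e i} {suc (suc i)} {suc i} m x< (λ eq → 1+n≢n (sym eq)) row)
       (row-write {Layer e (suc i)} {suc (suc i)} m x< row′ (layer-suc {e} {i} {x} i<n (row x x<) nb))
       (λ x′ lt → Covered-mono {e} {i} (bump-left b _) (cov x′ lt))
       (extend (λ x′ lt → Covered-mono {e} {suc i} (bump-left b _) (cov′ x′ lt))
          (covered-suc {e} {i} {x} i<n nb (bump-right b _) (Covered-mono {e} {i} (bump-left b _) (cov x x<))))
       (≤-trans b₀≤ (bump-left _ _)) (sound-bump so (threshold-range e<) u<)) })
    where
    B : ℕ
    B = read m (suc i * N + neighbour (2 ^ i) x)
    nb : Layer e i (neighbour (2 ^ i) x) B
    nb = row _ (neighbour-< {n} {i} i<n x<)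
    y< : (B + N) mod N < N
    y< = mod-< N (B + N) 0<N
    u< : tuple x ((B + N) mod N) e < Z
    u< = tuple-< x< y< e<
    B+N≤ : B + N ≤ X
    B+N≤ with Layer.attained nb
    ... | y , y< , eq , B≡ = ≤-trans (≤-reflexive (trans (cong (_+ N) B≡) (cell-neighbour {e} {i} {x} i<n y eq))) (cell≤X e x y y<)
    tab″ : ∀ {v} → Table (write m (suc (suc i) * N + x) v)
    tab″ = table-keep {suc (suc i)} m x< (λ ()) tab

  data LayerInv (e b₀ i : ℕ) (σ : State 21) : Set where
    inv : ∀ {x y b A B m} → SearchState (threshold e) x y e b i (2 ^ i) A B m σ → Table m →
      Row (Layer e i) (suc i) N m → (∀ x′ → x′ < N → Covered e i x′ b) →
      b₀ ≤ b → Sound b → LayerInv e b₀ i σ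

  layer-run : ∀ {e b₀} i {σ} → e < E → i < n → Bounded σ → LayerInv e b₀ i σ →
    eval σ (reg rn ⊖ reg ri) ≢ 0 × Run layerC σ (layerTime n) 0 (LayerInv e b₀ (suc i))
  layer-run {e} {b₀} i e< i<n bd (inv st tab row cov b₀≤ so) = m>n⇒m∸n≢0 i<n ,
    (run-set bd z≤n λ bd →
     run-while₀ (CellInv e b₀ i) N (λ x x< → cell-run x e< i<n x<) (λ { _ (inv st _ _ _ _ _ _ _) → n∸n≡0 N }) bd
       (inv st tab row (λ _ ()) cov (λ _ ()) b₀≤ so) ▸ λ { bd (inv st tab row row′ cov cov′ b₀≤ so) →
     run-set bd (≤-trans (^-monoʳ-≤ 2 i<n) N≤X) λ bd →
     run-last bd (≤-trans i<n (≤-trans (n≤1+n n) 1+n≤X)) (inv st tab row′ cov′ b₀≤ so) })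

  data EpochInv (e : ℕ) (σ : State 21) : Set where
    inv : ∀ {D x y b i p A B m} → SearchState D x y e b i p A B m σ → Table m →
      AllCovered e b → Sound b → EpochInv e σ

  epoch-run : ∀ e {σ} → e < E → Bounded σ → EpochInv e σ →
    eval σ ((lit 1 ⊹ lit γ ⊛ reg rn) ⊛ reg rP ⊖ reg re) ≢ 0 × Run epochC σ (epochTime n) 0 (EpochInv (suc e))
  epoch-run e e< bd (inv {b = b₀} st tab cov so) = m>n⇒m∸n≢0 e< ,
    (run-set bd (D≤X (proj₂ (threshold-range e<))) λ bd → run-set bd z≤n λ bd →
     run-while₀ (StartInv e b₀) N (λ x → start-run x e<) (λ { _ (inv st _ _ _ _ _) → n∸n≡0 N }) bd
       (inv st tab (λ _ ()) (λ _ ()) ≤-refl so) ▸ λ { bd (inv st tab row cov₀ b₀≤ so) →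
     run-set bd z≤n λ bd → run-set bd (≤-trans 0<N N≤X) λ bd →
     run-while₀ (LayerInv e b₀) n (λ i → layer-run i e<) (λ { _ (inv st _ _ _ _ _) → n∸n≡0 n }) bd
       (inv st tab row cov₀ b₀≤ so) ▸ λ { bd (inv st tab row covₙ b₀≤ so) →
     run-last bd (≤-trans e< E≤X) (inv st tab
       (extend (λ e′ lt x x< → Covered-mono {e′} {n} b₀≤ (cov e′ lt x x<)) covₙ) so) } })

  setup : (N P x y i : ℕ) → List ℕ → State 21
  setup N P x y i m = ⟨ 0 ∷ 0 ∷ 0 ∷ 0 ∷ n ∷ N ∷ P ∷ 0 ∷ 0 ∷ 0 ∷ 0 ∷ 0 ∷ 0 ∷ x ∷ y ∷ 0 ∷ 0 ∷ i ∷ 0 ∷ 0 ∷ 0 ∷ [] , m ⟩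

  double-run : ∀ i {σ} → i < n → Bounded σ → σ ≡ setup (2 ^ i) 0 0 0 i (n ∷ []) →
    eval σ (reg rn ⊖ reg ri) ≢ 0 × Run doubleC σ 2 0 (_≡ setup (2 ^ suc i) 0 0 0 (suc i) (n ∷ []))
  double-run i i<n bd refl = m>n⇒m∸n≢0 i<n ,
    (run-set bd (≤-trans (^-monoʳ-≤ 2 i<n) N≤X) λ bd →
     run-last bd (≤-trans i<n (≤-trans (n≤1+n n) 1+n≤X)) refl)

  power-run : ∀ k {p x y i m} → k ≤ t → Bounded (setup N p x y i m) →
    Run (powerC k) (setup N p x y i m) (suc k) 0 (_≡ setup N (N ^ k) x y i m)
  power-run zero    k≤ bd = run-last bd (≤-trans 0<N N≤X) refl
  power-run (suc k) k≤ bd = run-time (≤-reflexive (+-comm (suc k) 1)) (power-run k (<⇒≤ k≤) bd ▸ λ { bd refl →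
    run-last bd (≤-trans (^-monoʳ-≤ N {{>-nonZero 0<N}} k≤) P≤X) refl })

  data TableInv (x : ℕ) (σ : State 21) : Set where
    inv : ∀ {y m} → σ ≡ setup N P x y n m →
      (∀ x′ → x′ < x → read m x′ ≡ (if f (toPoint n x′) then 1 else 0)) → TableInv x σ

  table-run : ∀ x {σ} → x < N → Bounded σ → TableInv x σ →
    eval σ (reg rN ⊖ reg rx) ≢ 0 × Run tableC σ 3 1 (TableInv (suc x))
  table-run x x< bd (inv {m = m} refl tab) = m>n⇒m∸n≢0 x< ,
    (run-query bd (≤-trans 0<N N≤X) λ bd →
     run-store bd (address-< {0} z<s x<) (lookup≤ bd ry) λ bd →
     run-last bd (≤-trans x< N≤X) (inv refl
       (row-write {λ x c → c ≡ (if f (toPoint n x) then 1 else 0)} {0} m x< tab refl)))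

  -- That cells below `a` survive is what the induction needs in order to know that an output cell,
  -- once written, is not touched by later stores.
  out-run : ∀ a k {D x y e b i p A B m σ} → a + k ≤ L → Bounded σ → SearchState D x y e b i p A B m σ →
    Run (outC a k) σ (suc (2 * k)) 0 (λ σ′ →
      (∀ a′ → a′ < a → read (mem σ′) a′ ≡ read m a′) ×
      tabulate (λ (j : Fin k) → toPoint n (read (mem σ′) (a + toℕ j))) ≡ decode n k b)
  out-run a zero a≤ bd st = run-skip bd ((λ _ _ → refl) , refl)
  out-run a (suc k) {b = b} {m = m} a≤ bd st = run-time (≤-reflexive (cong suc (time≡ k)))
    (run-store bd (≤-trans (m≤m+n (suc a) k) (≤-trans (≤-reflexive (sym (+-suc a k))) a≤)) (lookup≤ bd rm) λ bd →
     run-set bd (≤-trans (÷-≤ b N) (lookup≤ bd rm)) λ bd →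
     run-post (λ {σ′} → λ { (keep , eq) →
         (λ a′ lt → trans (keep a′ (m<n⇒m<1+n lt)) (read-write-≢ m a b (<⇒≢ lt))) ,
         cong₂ _∷_ (cong (toPoint n) (trans (cong (read (mem σ′)) (+-identityʳ a)) (trans (keep a ≤-refl) (read-write-≡ m a b))))
           (trans (tabulate-cong (λ j → cong (λ z → toPoint n (read (mem σ′) z)) (+-suc a (toℕ j)))) eq) })
       (out-run (suc a) k (≤-trans (≤-reflexive (sym (+-suc a k))) a≤) bd st))
    where
    time≡ : ∀ k → suc (suc (2 * k)) ≡ 2 * suc k
    time≡ = solve-∀

  setup→search : ∀ {x y m} → SearchState 0 x y 0 0 n 0 0 0 m (setup N P x y n m)
  setup→search = st

  Final : State 21 → Set
  Final σ = ∃[ b ] (AllCovered E b × Sound b × output n s σ ≡ decode n s (b mod Z))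

  initial-bounded : Bounded (initial n)
  initial-bounded = bounded (z≤n ∷ z≤n ∷ z≤n ∷ z≤n ∷ z≤n ∷ z≤n ∷ z≤n ∷ z≤n ∷ z≤n ∷ z≤n ∷ z≤n ∷ z≤n ∷ z≤n ∷ z≤n ∷ z≤n ∷ z≤n ∷ z≤n ∷ z≤n ∷ z≤n ∷ z≤n ∷ z≤n ∷ [])
    (≤-trans (n≤1+n n) 1+n≤X ∷ []) (≤-trans (s≤s z≤n) (m≤n+m s (suc (suc n) * N)))

  main-run : Run mainC (initial n) (mainTime n) N Final
  -- All oracle calls come from the loop that fills row 0, one per cell.
  main-run = subst (λ q → Run mainC (initial n) (mainTime n) q Final) (trans (+-identityʳ (N * 1)) (*-identityʳ N))
    (run-load initial-bounded λ bd → run-set bd (≤-trans 0<N N≤X) λ bd →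
     run-while₀ (λ i σ → σ ≡ setup (2 ^ i) 0 0 0 i (n ∷ [])) n double-run (λ { _ refl → n∸n≡0 n }) bd refl ▸ λ { bd refl →
     power-run t ≤-refl bd ▸ λ { bd refl →
     run-while TableInv N N refl table-run (λ { _ (inv refl _) → n∸n≡0 N }) bd (inv refl (λ _ ())) ▸ λ { bd (inv refl tab) →
     run-while₀ EpochInv E epoch-run (λ { _ (inv st _ _ _) → n∸n≡0 E }) bd (inv setup→search tab (λ _ ()) (inj₁ refl)) ▸ λ { bd (inv {b = b} st tab cov so) →
     run-set bd (≤-trans (mod-≤ b Z) (lookup≤ bd rm)) λ bd →
     run-post (λ { (_ , eq) → b , cov , so , eq }) (out-run 0 s (m≤n+m s (suc (suc n) * N)) bd st) } } } })

-- From scattered tuples to the three optimization problems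

module _ {A : Set} where

  ∈-tuples⁺ : ∀ {k xs} {zs : Vec A k} → All (_∈ xs) zs → zs ∈ tuples k xs
  ∈-tuples⁺ []       = here refl
  ∈-tuples⁺ (p ∷ ps) = ∈-cartesianProductWith⁺ _∷_ p (∈-tuples⁺ ps)

  ∈-tuples⁻ : ∀ k xs {zs : Vec A k} → zs ∈ tuples k xs → All (_∈ xs) zs
  ∈-tuples⁻ zero    xs {[]} _ = []
  ∈-tuples⁻ (suc k) xs {zs} p with ∈-cartesianProductWith⁻ _∷_ xs (tuples k xs) p
  ... | z , zs′ , z∈ , zs∈ , refl = z∈ ∷ ∈-tuples⁻ k xs zs∈

  tuples-unique : ∀ k {xs : List A} → LUnique.Unique xs → LUnique.Unique (tuples k xs)
  tuples-unique zero    u = [] LAllPairs.∷ LAllPairs.[]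
  tuples-unique (suc k) u = cartesianProductWith⁺ _∷_ ∷-injective u (tuples-unique k u)

  prefix : ∀ k (xs : List A) → LUnique.Unique xs → k ≤ length xs → ∃[ zs ] (All (_∈ xs) {k} zs × Unique zs)
  prefix zero    xs       u                     k≤       = [] , [] , []
  prefix (suc k) (x ∷ xs) (x∉ LAllPairs.∷ u) (s≤s k≤) with prefix k xs u k≤
  ... | zs , zs⊆ , u′ = x ∷ zs , here refl ∷ All.map there zs⊆ , All.map (LAll.lookup x∉) zs⊆ ∷ u′

  maximum-≡ : ∀ (g : A → ℕ) {xs x} → x ∈ xs → (∀ {y} → y ∈ xs → g y ≤ g x) → maximum g xs ≡ g x
  maximum-≡ g {xs} {x} x∈ ub = ≤-antisym
    (max≤v⁺ z≤n (map-All⁺ (LAll.tabulate ub)))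
    (LAll.lookup (xs≤max 0 (List.map g xs)) (∈-map⁺ g x∈))

module _ {n : ℕ} (f : Point n → Bool) where

  ∈-solutions⁺ : ∀ {z} → f z ≡ true → z ∈ solutions f
  ∈-solutions⁺ {z} fz = ∈-filter⁺ (T? ∘ f) (∈-tuples⁺ (all-bits z)) (Equivalence.from T-≡ fz)
    where
    all-bits : ∀ {k} (z : Point k) → All (_∈ false ∷ true ∷ []) z
    all-bits []          = []
    all-bits (false ∷ z) = here refl ∷ all-bits z
    all-bits (true ∷ z)  = there (here refl) ∷ all-bits z

  ∈-solutions⁻ : ∀ {z} → z ∈ solutions f → f z ≡ true
  ∈-solutions⁻ p = Equivalence.to T-≡ (proj₂ (∈-filter⁻ (T? ∘ f) {xs = tuples n (false ∷ true ∷ [])} p))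

  solutions-unique : LUnique.Unique (solutions f)
  solutions-unique = filter⁺ (T? ∘ f) (tuples-unique n (((λ ()) ∷ []) LAllPairs.∷ ([] LAllPairs.∷ LAllPairs.[])))

  ∈-valid⁺ : ∀ {k} {zs : Vec (Point n) k} → zs ⊆ f ⁻¹1 → zs ∈ tuples k (solutions f)
  ∈-valid⁺ zs⊆ = ∈-tuples⁺ (All.map ∈-solutions⁺ zs⊆)

  ∈-valid⁻ : ∀ {k} {zs : Vec (Point n) k} → zs ∈ tuples k (solutions f) → zs ⊆ f ⁻¹1
  ∈-valid⁻ {k} zs∈ = All.map ∈-solutions⁻ (∈-tuples⁻ k (solutions f) zs∈)

  ∈-distinct⁺ : ∀ {k} {zs : Vec (Point n) k} → zs ⊆ f ⁻¹1 → Unique zs → zs ∈ distinctTuples k (solutions f)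
  ∈-distinct⁺ zs⊆ u = ∈-filter⁺ unique? (∈-valid⁺ zs⊆) u

  ∈-distinct⁻ : ∀ {k} {zs : Vec (Point n) k} → zs ∈ distinctTuples k (solutions f) → zs ⊆ f ⁻¹1 × Unique zs
  ∈-distinct⁻ {k} zs∈ with ∈-filter⁻ unique? {xs = tuples k (solutions f)} zs∈
  ... | p , u = ∈-valid⁻ p , u

  distinct-solutions : ∀ {k} → k ≤ #solutions f → ∃[ zs ] (_⊆_⁻¹1 {n} {k} zs f × Unique zs)
  distinct-solutions {k} k≤ with prefix k (solutions f) solutions-unique k≤
  ... | zs , zs⊆ , u = zs , All.map ∈-solutions⁻ zs⊆ , u

  full⇒valid : ∀ {D k} {zs : Vec (Point n) k} → Full f D zs → zs ⊆ f ⁻¹1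
  full⇒valid {zs = []}     _               = []
  full⇒valid {zs = z ∷ zs} (fz , _ , full) = fz ∷ full⇒valid full

  full-0 : ∀ {k} {zs : Vec (Point n) k} → zs ⊆ f ⁻¹1 → Full f 0 zs
  full-0 []         = tt
  full-0 (fz ∷ zs⊆) = fz , All.universal (λ _ → z≤n) _ , full-0 zs⊆

  full⇒unique : ∀ {D k} {zs : Vec (Point n) k} → 1 ≤ D → Full f D zs → Unique zs
  full⇒unique {zs = []}     1≤D _               = []
  full⇒unique {zs = z ∷ zs} 1≤D (_ , far , full) =
    All.map (λ {y} D≤ z≡y → contradiction (≤-trans 1≤D (≤-trans D≤ (≤-reflexive (trans (cong (d_H z) (sym z≡y)) (d_H-refl z))))) 1+n≰n) far
      ∷ full⇒unique 1≤D full

  1≤d_H : ∀ (x y : Point n) → x ≢ y → 1 ≤ d_H x y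
  1≤d_H x y x≢y = n≢0⇒n>0 (x≢y ∘ d_H≡0⇒≡ x y)

  full-1 : ∀ {k} {zs : Vec (Point n) k} → zs ⊆ f ⁻¹1 → Unique zs → Full f 1 zs
  full-1 []         []       = tt
  full-1 (fz ∷ zs⊆) (z∉ ∷ u) = fz , All.map (1≤d_H _ _) z∉ , full-1 zs⊆ u

  full⇒distances : ∀ {D k} (zs : Vec (Point n) k) → Full f D zs → LAll.All (D ≤_) (pairDistances zs)
  full⇒distances []       _                = []
  full⇒distances (z ∷ zs) (_ , far , full) = ++⁺ (list far) (full⇒distances zs full)
    where
    list : ∀ {k D} {ys : Vec (Point n) k} → All (λ y → D ≤ d_H z y) ys → LAll.All (D ≤_) (Vec.toList (Vec.map (d_H z) ys))
    list []       = []
    list (p ∷ ps) = p ∷ list ps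

  distances⇒full : ∀ {D k} {zs : Vec (Point n) k} → zs ⊆ f ⁻¹1 → LAll.All (D ≤_) (pairDistances zs) → Full f D zs
  distances⇒full {zs = []}     []         _  = tt
  distances⇒full {zs = z ∷ zs} (fz ∷ zs⊆) ds =
    fz , vec zs (++⁻ˡ (Vec.toList (Vec.map (d_H z) zs)) ds) , distances⇒full zs⊆ (++⁻ʳ (Vec.toList (Vec.map (d_H z) zs)) ds)
    where
    vec : ∀ {k D} (ys : Vec (Point n) k) → LAll.All (D ≤_) (Vec.toList (Vec.map (d_H z) ys)) → All (λ y → D ≤ d_H z y) ys
    vec []       []       = []
    vec (y ∷ ys) (p ∷ ps) = p ∷ vec ys ps

  minPD-full : ∀ {k} {zs : Vec (Point n) k} → zs ⊆ f ⁻¹1 → Full f (minPD zs) zs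
  minPD-full {zs = zs} zs⊆ = distances⇒full zs⊆ (min≤xs n (pairDistances zs))

  full⇒≤minPD : ∀ {D k} {zs : Vec (Point n) k} → D ≤ n → Full f D zs → D ≤ minPD zs
  full⇒≤minPD {zs = zs} D≤n full = v≤min⁺ D≤n (full⇒distances zs full)

  replicate⁺ : ∀ {z} → f z ≡ true → ∀ k → Vec.replicate k z ⊆ f ⁻¹1
  replicate⁺ fz zero    = []
  replicate⁺ fz (suc k) = fz ∷ replicate⁺ fz k

  Finds : (t α lo γ : ℕ) → Vec (Point n) (suc (suc t)) → Set
  Finds t α lo γ zs = ∀ D (ys : Vec (Point n) (suc (suc t))) → InRange D → Full f D ys → ∃[ D′ ] (InRange D′ × Optimal D′ zs)
    where open Search t α lo γ n f

  finds-max-sum : ∀ {t zs} → Nonempty f → Finds t 1 0 0 zs → zs ⊆ f ⁻¹1 × sumPD zs ≡ OptSum f (suc (suc t))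
  finds-max-sum {t} {zs} (z , fz) finds with finds 0 (Vec.replicate _ z) (z≤n , z≤n) (full-0 (replicate⁺ fz (suc (suc t))))
  ... | .0 , (_ , z≤n) , full , best = full⇒valid full ,
    sym (maximum-≡ sumPD (∈-valid⁺ (full⇒valid full)) λ {ys} ys∈ →
      subst₂ _≤_ (simplify ys) (simplify zs) (best 0 ys (z≤n , z≤n) (full-0 (∈-valid⁻ ys∈))))
    where
    simplify : ∀ ys → 1 * sumPD ys + 0 ≡ sumPD ys
    simplify ys = trans (+-identityʳ _) (*-identityˡ _)

  finds-max-distinct-sum : ∀ {t zs} → Finds t 1 1 0 zs → suc (suc t) ≤ #solutions f →
    zs ⊆ f ⁻¹1 × Unique zs × sumPD zs ≡ OptSum≠ f (suc (suc t))
  finds-max-distinct-sum {t} {zs} finds s≤ with distinct-solutions s≤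
  ... | ys , ys⊆ , u with finds 1 ys (≤-refl , ≤-refl) (full-1 ys⊆ u)
  ... | .1 , (s≤s z≤n , s≤s z≤n) , full , best = full⇒valid full , full⇒unique {zs = zs} ≤-refl full ,
    sym (maximum-≡ sumPD (∈-distinct⁺ (full⇒valid full) (full⇒unique {zs = zs} ≤-refl full)) λ {ys} ys∈ →
      subst₂ _≤_ (*-identityˡ _) (*-identityˡ _) (+-cancelʳ-≤ 1 _ _
        (best 1 ys (≤-refl , ≤-refl) (full-1 (proj₁ (∈-distinct⁻ ys∈)) (proj₂ (∈-distinct⁻ ys∈))))))

  -- Any tuple of solutions is scattered for its own `minPD`, so the largest threshold `D` found
  -- satisfies `minPD ys ≤ D ≤ minPD zs`. Distinctness is a consequence: distinct solutions have
  -- `minPD` at least 1, hence so does the optimum.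
  finds-max-min : ∀ {t zs} → Nonempty f → Finds t 0 0 1 zs →
    zs ⊆ f ⁻¹1 × (suc (suc t) ≤ #solutions f → Unique zs) × minPD zs ≡ OptMin f (suc (suc t))
  finds-max-min {t} {zs} (z , fz) finds with finds 0 (Vec.replicate _ z) (z≤n , z≤n) (full-0 (replicate⁺ fz (suc (suc t))))
  ... | D , (_ , D≤) , full , best = valid , unique , minPD-max (suc (suc t) ≤? #solutions f)
    where
    valid : zs ⊆ f ⁻¹1
    valid = full⇒valid full
    D≤n : D ≤ n
    D≤n = ≤-trans D≤ (≤-reflexive (*-identityˡ n))
    minPD-≤ : ∀ {ys : Vec (Point n) (suc (suc t))} → ys ⊆ f ⁻¹1 → minPD ys ≤ minPD zs
    minPD-≤ {ys} ys⊆ = ≤-trans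
      (best (minPD ys) ys (z≤n , ≤-trans (min≤⊤ n (pairDistances ys)) (≤-reflexive (sym (*-identityˡ n)))) (minPD-full ys⊆))
      (full⇒≤minPD D≤n full)
    -- The minimum in `minPD` starts at `n`, so a lower bound 1 on it requires `1 ≤ n`, which two
    -- distinct points provide.
    1≤n : ∀ {ys : Vec (Point n) (suc (suc t))} → Unique ys → 1 ≤ n
    1≤n {x ∷ y ∷ _} ((x≢y ∷ _) ∷ _) = ≤-trans (1≤d_H x y x≢y) (d_H-≤ x y)
    unique : suc (suc t) ≤ #solutions f → Unique zs
    unique s≤ with distinct-solutions s≤
    ... | ys , ys⊆ , u = full⇒unique (≤-trans (full⇒≤minPD (1≤n u) (full-1 ys⊆ u)) (minPD-≤ ys⊆)) (minPD-full valid)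
    minPD-max : (s≤? : Dec (suc (suc t) ≤ #solutions f)) →
      minPD zs ≡ (if does s≤? then maximum minPD (distinctTuples (suc (suc t)) (solutions f))
                              else maximum minPD (tuples (suc (suc t)) (solutions f)))
    minPD-max (yes s≤) = sym (maximum-≡ minPD (∈-distinct⁺ valid (unique s≤)) (λ ys∈ → minPD-≤ (proj₁ (∈-distinct⁻ ys∈))))
    minPD-max (no  _)  = sym (maximum-≡ minPD (∈-valid⁺ valid) (λ ys∈ → minPD-≤ (∈-valid⁻ ys∈)))

-- Growth up to polynomial factors

Positive : (ℕ → ℕ) → Set
Positive h = ∀ n → 1 ≤ h n

Poly : (ℕ → ℕ) → Set
Poly = O* (λ _ → 1)

O*-refl : ∀ h → O* h h
O*-refl h = 1 , 0 , λ n → ≤-reflexive (sym (*-identityˡ (h n)))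

O*-≤ : ∀ {h h′ g} → (∀ n → h n ≤ h′ n) → O* h g → O* h′ g
O*-≤ h≤ (c , d , b) = c , d , λ n → ≤-trans (b n) (*-monoʳ-≤ (c * suc n ^ d) (h≤ n))

O*-const : ∀ {h} k → Positive h → O* h (λ _ → k)
O*-const k pos = k , 0 , λ n → ≤-trans (≤-reflexive (sym (*-identityʳ k))) (≤-trans (m≤m*n (k * 1) _ {{>-nonZero (pos n)}}) ≤-refl)

O*-+ : ∀ {h g g′} → O* h g → O* h g′ → O* h (λ n → g n + g′ n)
O*-+ {h} {g} {g′} (c , d , b) (c′ , d′ , b′) = c + c′ , d + d′ , λ n → begin
  g n + g′ n                                              ≤⟨ +-mono-≤ (b n) (b′ n) ⟩
  c * suc n ^ d * h n + c′ * suc n ^ d′ * h n             ≤⟨ +-mono-≤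
    (*-monoˡ-≤ (h n) (*-monoʳ-≤ c (^-monoʳ-≤ (suc n) (m≤m+n d d′))))
    (*-monoˡ-≤ (h n) (*-monoʳ-≤ c′ (^-monoʳ-≤ (suc n) (m≤n+m d′ d)))) ⟩
  c * suc n ^ (d + d′) * h n + c′ * suc n ^ (d + d′) * h n ≡⟨ factor c c′ (suc n ^ (d + d′)) (h n) ⟩
  (c + c′) * suc n ^ (d + d′) * h n                       ∎
  where
  open ≤-Reasoning
  factor : ∀ c c′ p h → c * p * h + c′ * p * h ≡ (c + c′) * p * h
  factor = solve-∀

O*-* : ∀ {h h′ g g′} → O* h g → O* h′ g′ → O* (λ n → h n * h′ n) (λ n → g n * g′ n)
O*-* {h} {h′} {g} {g′} (c , d , b) (c′ , d′ , b′) = c * c′ , d + d′ , λ n → begin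
  g n * g′ n                                        ≤⟨ *-mono-≤ (b n) (b′ n) ⟩
  c * suc n ^ d * h n * (c′ * suc n ^ d′ * h′ n)    ≡⟨ regroup c c′ (suc n ^ d) (suc n ^ d′) (h n) (h′ n) ⟩
  c * c′ * (suc n ^ d * suc n ^ d′) * (h n * h′ n)  ≡⟨ cong (λ z → c * c′ * z * (h n * h′ n)) (^-distribˡ-+-* (suc n) d d′) ⟨
  c * c′ * suc n ^ (d + d′) * (h n * h′ n)          ∎
  where
  open ≤-Reasoning
  regroup : ∀ c c′ p p′ h h′ → c * p * h * (c′ * p′ * h′) ≡ c * c′ * (p * p′) * (h * h′)
  regroup = solve-∀

O*-*-Poly : ∀ {h g p} → O* h g → Poly p → O* h (λ n → g n * p n)
O*-*-Poly {h} og pp = O*-≤ (λ n → ≤-reflexive (*-identityʳ (h n))) (O*-* og pp)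

O*-Poly-* : ∀ {h g p} → Poly p → O* h g → O* h (λ n → p n * g n)
O*-Poly-* {h} pp og = O*-≤ (λ n → ≤-reflexive (*-identityˡ (h n))) (O*-* pp og)

O*-suc : ∀ {h g} → Positive h → O* h g → O* h (suc ∘ g)
O*-suc pos og = O*-+ (O*-const 1 pos) og

Poly⇒O* : ∀ {h g} → Positive h → Poly g → O* h g
Poly⇒O* pos = O*-≤ pos

poly-const : ∀ k → Poly (λ _ → k)
poly-const k = O*-const k (λ _ → ≤-refl)

poly-id : Poly (λ n → n)
poly-id = 1 , 1 , λ n → ≤-trans (n≤1+n n) (≤-reflexive (sym
  (trans (*-identityʳ (1 * suc n ^ 1)) (trans (*-identityˡ (suc n ^ 1)) (^-identityʳ (suc n))))))

poly-suc : ∀ {g} → Poly g → Poly (suc ∘ g)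
poly-suc = O*-suc (λ _ → ≤-refl)

-- Numbers may be exponentially large, but costs are charged in bits; closure of this class under
-- the arithmetic in `X` makes the charge per step polynomial.
record ShortBits (g : ℕ → ℕ) : Set where
  constructor short
  field poly : Poly (bits ∘ g)

O*-bound : ∀ {h g g′} → (∀ n → g n ≤ g′ n) → O* h g′ → O* h g
O*-bound g≤ (c , d , b) = c , d , λ n → ≤-trans (g≤ n) (b n)

short-const : ∀ k → ShortBits (λ _ → k)
short-const k = short (poly-const (bits k))

short-+ : ∀ {g g′} → ShortBits g → ShortBits g′ → ShortBits (λ n → g n + g′ n)
short-+ {g} {g′} (short p) (short p′) = short (O*-bound (λ n → bits-+ (g n) (g′ n)) (poly-suc (O*-+ p p′)))

short-* : ∀ {g g′} → ShortBits g → ShortBits g′ → ShortBits (λ n → g n * g′ n)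
short-* {g} {g′} (short p) (short p′) = short (O*-bound (λ n → bits-* (g n) (g′ n)) (poly-suc (O*-+ p p′)))

short-2^ : ShortBits (2 ^_)
short-2^ = short (O*-bound (λ n → ≤-reflexive (bits-2^ n)) (poly-suc poly-id))

short-id : ShortBits (λ n → n)
short-id = short (O*-bound (λ n → bits-mono-≤ (<⇒≤ (n<2^n n))) (ShortBits.poly short-2^))

short-^ : ∀ {g} k → ShortBits g → ShortBits (λ n → g n ^ k)
short-^ zero    sg = short-const 1
short-^ (suc k) sg = short-* sg (short-^ k sg)

2^-positive : Positive (2 ^_)
2^-positive = 0<2^

-- Time and space bounds

module Complexity (t α lo γ : ℕ) where

  open Program t α lo γ

  -- `X` and `L` have the same value for every `f`; a constant function serves to name them, as the
  -- bounds must be uniform in `f`.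
  Xₙ Lₙ βₙ : ℕ → ℕ
  Xₙ n = Search.X t α lo γ n (λ _ → false)
  Lₙ n = Search.L t α lo γ n (λ _ → false)
  βₙ n = bits (Xₙ n)

  E-bound : ℕ → ℕ
  E-bound n = (1 + γ * n) * (2 ^ n) ^ t

  linear : ∀ a → ShortBits (λ n → a * n)
  linear a = short-* (short-const a) short-id

  short-X : ShortBits Xₙ
  short-X = short-+ {λ n → keyCap n + cellCap n} {λ n → maxCount s + s * s * n + suc n}
    (short-+ {keyCap} {cellCap}
      (short-* {λ n → 2 + α * (s * s * n) + (lo + γ * n)} {Z′}
        (short-+ {λ n → 2 + α * (s * s * n)} {λ n → lo + γ * n}
          (short-+ {λ _ → 2} (short-const 2) (short-* {λ _ → α} (short-const α) (linear (s * s))))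
          (short-+ {λ _ → lo} (short-const lo) (linear γ)))
        (short-* {λ n → 2 ^ n * 2 ^ n} (short-* short-2^ short-2^)
          (short-* {λ n → 1 + γ * n} (short-+ {λ _ → 1} (short-const 1) (linear γ)) (short-^ t short-2^))))
      (short-* {2 ^_} short-2^
        (short-+ {λ _ → 1} (short-const 1)
          (short-+ {λ n → κ * 2 ^ n * maxCount (suc t) + α * (suc t * suc t * n)}
            (short-+ {λ n → κ * 2 ^ n * maxCount (suc t)}
              (short-* {λ n → κ * 2 ^ n} (short-* {λ _ → κ} (short-const κ) short-2^) (short-const (maxCount (suc t))))
              (short-* {λ _ → α} (short-const α) (linear (suc t * suc t))))
            short-id))))
    (short-+ {λ n → maxCount s + s * s * n}
      (short-+ {λ _ → maxCount s} (short-const (maxCount s)) (linear (s * s)))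
      (short-+ {λ _ → 1} (short-const 1) short-id))
    where
    Z′ keyCap cellCap : ℕ → ℕ
    Z′ n = 2 ^ n * 2 ^ n * E-bound n
    keyCap n = (2 + α * (s * s * n) + (lo + γ * n)) * Z′ n
    cellCap n = 2 ^ n * suc (κ * 2 ^ n * maxCount (suc t) + α * (suc t * suc t * n) + n)

  β-poly : Poly βₙ
  β-poly = ShortBits.poly short-X

  loop-O* : ∀ {h g} → Positive h → O* h g → O* h (λ n → g n + 1)
  loop-O* pos og = O*-+ og (O*-const 1 pos)

  poly-+1 : ∀ {g} → Poly g → Poly (λ n → g n + 1)
  poly-+1 = loop-O* (λ _ → ≤-refl)

  dist-poly : Poly distTime
  dist-poly = poly-suc (poly-suc (poly-+1 (O*-*-Poly poly-id (poly-const 5))))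

  pairs-poly : ∀ m → Poly (λ n → pairsTime n m)
  pairs-poly zero    = poly-const 1
  pairs-poly (suc m) = poly-suc (poly-suc (O*-+ dist-poly (O*-+ (poly-const 3) (pairs-poly m))))

  digits-poly : ∀ m → Poly (λ n → digitsTime n m)
  digits-poly zero    = poly-const 1
  digits-poly (suc m) = O*-+ (poly-const 5) (O*-+ (pairs-poly m) (digits-poly m))

  score-poly : ∀ m → Poly (λ n → scoreTime n m)
  score-poly m = O*-+ (poly-const 2) (digits-poly m)

  candidate-poly : Poly candidateTime
  candidate-poly = poly-suc (poly-+1 (score-poly s))

  start-poly : Poly startTime
  start-poly = poly-suc (O*-+ (score-poly (suc t)) (O*-+ (poly-const 2) (poly-+1 candidate-poly)))

  cell-poly : Poly cellTime
  cell-poly = O*-+ (poly-const 5) (poly-+1 candidate-poly)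

  row-O* : ∀ {g} → Poly g → O* (2 ^_) (λ n → 2 ^ n * suc (g n) + 1)
  row-O* pg = loop-O* 2^-positive (O*-*-Poly (O*-refl (2 ^_)) (poly-suc pg))

  layer-O* : O* (2 ^_) layerTime
  layer-O* = O*-suc 2^-positive (O*-+ (row-O* cell-poly) (O*-const 2 2^-positive))

  epoch-O* : O* (2 ^_) epochTime
  epoch-O* = O*-+ (O*-const 2 2^-positive) (O*-+ (row-O* start-poly) (O*-+ (O*-const 2 2^-positive)
    (loop-O* 2^-positive (loop-O* 2^-positive (O*-Poly-* poly-id (O*-suc 2^-positive layer-O*))))))

  target : ℕ → ℕ
  target n = 2 ^ (suc t * n)

  target-positive : Positive target
  target-positive n = 0<2^ (suc t * n)

  2^≤target : ∀ n → 2 ^ n ≤ target n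
  2^≤target n = ^-monoʳ-≤ 2 (m≤m+n n (t * n))

  -- The first factor counts the choices of all but two points, the second the cells of a row;
  -- `t + 1` is `s - 1`.
  target-split : ∀ n → (2 ^ n) ^ t * 2 ^ n ≡ target n
  target-split n = trans (*-comm ((2 ^ n) ^ t) (2 ^ n)) (trans (cong (2 ^ n *_) (trans (^-*-assoc 2 n t) (cong (2 ^_) (*-comm n t))))
    (sym (^-distribˡ-+-* 2 n (t * n))))

  search-O* : O* target (λ n → (1 + γ * n) * (2 ^ n) ^ t * suc (epochTime n))
  search-O* = O*-≤ (λ n → ≤-reflexive (target-split n))
    (O*-* {λ n → (2 ^ n) ^ t} {2 ^_}
      (O*-Poly-* {λ n → (2 ^ n) ^ t} (poly-suc (O*-Poly-* (poly-const γ) poly-id)) (O*-refl (λ n → (2 ^ n) ^ t)))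
      (O*-suc 2^-positive epoch-O*))

  main-O* : O* target mainTime
  main-O* = O*-+ (O*-const 2 target-positive) (O*-+ (Poly⇒O* target-positive (poly-+1 (O*-*-Poly poly-id (poly-const 3))))
    (O*-+ (O*-const (suc t) target-positive) (O*-+ (loop-O* target-positive (O*-≤ 2^≤target (O*-*-Poly (O*-refl (2 ^_)) (poly-const 4))))
    (O*-+ (loop-O* target-positive search-O*) (O*-const _ target-positive)))))

  T S : ℕ → ℕ
  T n = mainTime n * (weight mainC * βₙ n)
  S n = weight mainC * βₙ n + (21 + Lₙ n) * βₙ n

  T-O* : O* target T
  T-O* = O*-*-Poly main-O* (O*-Poly-* (poly-const (weight mainC)) β-poly)

  S-O* : O* (2 ^_) S
  S-O* = O*-+ (Poly⇒O* 2^-positive (O*-Poly-* (poly-const (weight mainC)) β-poly))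
    (O*-*-Poly {p = βₙ} (O*-+ (O*-const 21 2^-positive)
      (O*-+ (O*-Poly-* (poly-suc (poly-suc poly-id)) (O*-refl (2 ^_))) (O*-const s 2^-positive))) β-poly)

  computes : ∀ {G : ∀ {n} → (Point n → Bool) → Vec (Point n) s → Set} →
    α ≡ 0 ⊎ α ≡ 1 × lo ≤ 1 × γ ≡ 0 →
    (∀ {n} (f : Point n → Bool) zs → Nonempty f → Finds f t α lo γ zs → G f zs) →
    Computes s algorithm G
  computes {G} mode guarantee = T , S , T-O* , S-O* , λ n f ne → result f ne (Correct.main-run t α lo γ n f)
    where
    result : ∀ {n} (f : Point n → Bool) → Nonempty f →
      Costed.Run (λ x → f (toPoint n x)) (Search.X t α lo γ n f) (Search.L t α lo γ n f) mainC (initial n) (mainTime n) (2 ^ n) (Correct.Final t α lo γ n f) →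
      ∃[ σ ] ∃[ κ ] ((algorithm ⇓[ f ] σ , κ) × calls κ ≡ 2 ^ n × time κ ≤ T n × space κ ≤ S n × G f (output n s σ))
    result {n} f ne (Costed.run exec time≤ space≤ calls≡ _ (b , covered , sound , out≡)) =
      _ , _ , exec , calls≡ , time≤ , space≤ ,
      subst (G f) (sym out≡) (guarantee f _ ne (Search.optimal t α lo γ n f mode sound covered))

theorem10 : (s : ℕ) → 2 ≤ s →
    ∃[ A₁ ] ∃[ A₂ ] ∃[ A₃ ]
    Computes s A₁ (λ f zs → zs ⊆ f ⁻¹1 × sumPD zs ≡ OptSum f s) ×
    Computes s A₂ (λ f zs → zs ⊆ f ⁻¹1 × (s ≤ #solutions f → Unique zs) × minPD zs ≡ OptMin f s) ×
    Computes s A₃ (λ f zs → s ≤ #solutions f → zs ⊆ f ⁻¹1 × Unique zs × sumPD zs ≡ OptSum≠ f s)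
theorem10 (suc (suc t)) (s≤s (s≤s z≤n)) =
  -- After `t` come `α`, the least threshold `lo`, and `γ`, for which the thresholds range over `lo`
  -- to `lo + γ * n`.
  Program.algorithm t 1 0 0 , Program.algorithm t 0 0 1 , Program.algorithm t 1 1 0 ,
  Complexity.computes t 1 0 0 (inj₂ (refl , z≤n , refl)) (λ f zs → finds-max-sum f) ,
  Complexity.computes t 0 0 1 (inj₁ refl) (λ f zs → finds-max-min f) ,
  Complexity.computes t 1 1 0 (inj₂ (refl , ≤-refl , refl)) (λ f zs _ → finds-max-distinct-sum f)
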